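{- Let $n = p^2$, where $p \geq 5$ is a prime number. Then the energy of the line graph $L(\Gamma(\mathbb{Z}_{p^2}))$ is $E(L(\Gamma(\mathbb{Z}_{p^2}))) = 2p^2-10p+8$.
   Context: For a positive integer $n$, $\mathbb{Z}_n$ is the ring of residue classes modulo $n$. The zero-divisor graph $\Gamma(\mathbb{Z}_n)$ is the simple undirected graph whose vertices are the nonzero zero-divisors of $\mathbb{Z}_n$ (nonzero $x \in \mathbb{Z}_n$ such that $xy = 0$ for some nonzero $y \in \mathbb{Z}_n$), with distinct vertices $x,y$ adjacent if and only if $xy=0$. The line graph $L(\Gamma(\mathbb{Z}_n))$ is the graph whose vertices are the edges of $\Gamma(\mathbb{Z}_n)$, two distinct vertices being adjacent if the corresponding edges share a common vertex in $\Gamma(\mathbb{Z}_n)$. The energy $E(G)$ of a finite graph $G$ is the sum of the absolute values of the eigenvalues (counted with multiplicity) of its adjacency matrix. -}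

module Defs where

open import Algebra.Bundles using (CommutativeRing)
import Algebra.Properties.CommutativeMonoid.Sum as MonoidSum
import Algebra.Properties.Semiring.Exp as Exp
open import Data.Bool.Base using (if_then_else_)
open import Data.Fin.Base as Fin using (Fin; zero; suc; toℕ; punchIn)
open import Data.Fin.Properties as Fin using (nonZeroIndex; any?)
open import Data.Integer.Base as ℤ using (ℤ)
open import Data.List.Base using (List; length; lookup; filter; allFin; cartesianProduct)
open import Data.List.Relation.Unary.Unique.Propositional using (Unique)
open import Data.List.Relation.Unary.Unique.Propositional.Properties as Unique using ()
open import Data.Nat.Base as ℕ using (ℕ; zero; suc; _≥_)
open import Data.Nat.DivMod using (_mod_)
import Data.Nat.Properties as ℕ
open import Data.Product.Base using (_×_; _,_; proj₁; proj₂; ∃; ∃-syntax; Σ-syntax)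
open import Data.Product.Properties using (≡-dec)
open import Data.Rational.Base as ℚ using (ℚ; 0ℚ; 1ℚ; ½)
import Data.Rational.Properties as ℚ
open import Data.Rational.Solver using (module +-*-Solver)
open import Data.Sum.Base using (_⊎_; inj₁; inj₂)
open import Function.Base using (_on_)
open import Level using (0ℓ; _⊔_)
open import Relation.Binary.Core using (Rel)
open import Relation.Binary.Definitions using (Decidable; DecidableEquality; Symmetric)
open import Relation.Binary.PropositionalEquality
  using (_≡_; _≢_; refl; sym; trans; cong; cong₂; subst; subst₂)
open import Relation.Nullary using (¬_; does; ¬?; _×-dec_; _⊎-dec_)
open import Relation.Unary as U using (Pred)

------------------------------------------------------------------------
-- The real numbers, as Cauchy sequences of rationals.  As usual without
-- quotients, equality of reals is the equivalence relation _≈ᴿ_.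

Null : (ℕ → ℚ) → Set
Null u = ∀ ε → 0ℚ ℚ.< ε → ∃[ N ] ∀ n → n ≥ N → ℚ.∣ u n ∣ ℚ.< ε

Cauchy : (ℕ → ℚ) → Set
Cauchy u = ∀ ε → 0ℚ ℚ.< ε →
           ∃[ N ] ∀ m n → m ≥ N → n ≥ N → ℚ.∣ u m ℚ.- u n ∣ ℚ.< ε

record ℝ : Set where
  no-eta-equality
  field
    seq    : ℕ → ℚ
    cauchy : Cauchy seq

open ℝ public

infix 4 _≈ᴿ_

record _≈ᴿ_ (x y : ℝ) : Set where
  constructor mk≈
  field
    null : Null (λ n → seq x n ℚ.- seq y n)

open _≈ᴿ_ public

private
  half>0 : ∀ {ε} → 0ℚ ℚ.< ε → 0ℚ ℚ.< ε ℚ.* ½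
  half>0 {ε} 0<ε = subst (ℚ._< ε ℚ.* ½) (ℚ.*-zeroˡ ½) (ℚ.*-monoˡ-<-pos ½ 0<ε)

  half+half : ∀ ε → ε ℚ.* ½ ℚ.+ ε ℚ.* ½ ≡ ε
  half+half ε = trans (sym (ℚ.*-distribˡ-+ ε ½ ½)) (ℚ.*-identityʳ ε)

  ∣p-q∣-sym : ∀ p q → ℚ.∣ p ℚ.- q ∣ ≡ ℚ.∣ q ℚ.- p ∣
  ∣p-q∣-sym p q = trans (sym (ℚ.∣-p∣≡∣p∣ (p ℚ.- q)))
    (cong ℚ.∣_∣ (solve 2 (λ p q → :- (p :- q) := q :- p) refl p q))
    where
    open +-*-Solver

  N⊔₁ : ∀ {M N n} → n ≥ M ℕ.⊔ N → n ≥ M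
  N⊔₁ {M} {N} h = ℕ.≤-trans (ℕ.m≤m⊔n M N) h

  N⊔₂ : ∀ {M N n} → n ≥ M ℕ.⊔ N → n ≥ N
  N⊔₂ {M} {N} h = ℕ.≤-trans (ℕ.m≤n⊔m M N) h

  ∣p∣≤⇒ : ∀ {p q} → p ℚ.≤ q → ℚ.- p ℚ.≤ q → ℚ.∣ p ∣ ℚ.≤ q
  ∣p∣≤⇒ {p} {q} h k with ℚ.∣p∣≡p∨∣p∣≡-p p
  ... | inj₁ e = subst (ℚ._≤ q) (sym e) h
  ... | inj₂ e = subst (ℚ._≤ q) (sym e) k

  ∣p∣-∣q∣≤ : ∀ p q → ℚ.∣ p ∣ ℚ.- ℚ.∣ q ∣ ℚ.≤ ℚ.∣ p ℚ.- q ∣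
  ∣p∣-∣q∣≤ p q = begin
    ℚ.∣ p ∣ ℚ.- ℚ.∣ q ∣
      ≡⟨ cong (λ h → ℚ.∣ h ∣ ℚ.- ℚ.∣ q ∣)
           (solve 2 (λ p q → p := (p :- q) :+ q) refl p q) ⟩
    ℚ.∣ (p ℚ.- q) ℚ.+ q ∣ ℚ.- ℚ.∣ q ∣
      ≤⟨ ℚ.+-monoˡ-≤ (ℚ.- ℚ.∣ q ∣) (ℚ.∣p+q∣≤∣p∣+∣q∣ (p ℚ.- q) q) ⟩
    (ℚ.∣ p ℚ.- q ∣ ℚ.+ ℚ.∣ q ∣) ℚ.- ℚ.∣ q ∣
      ≡⟨ solve 2 (λ a b → (a :+ b) :- b := a) refl ℚ.∣ p ℚ.- q ∣ ℚ.∣ q ∣ ⟩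
    ℚ.∣ p ℚ.- q ∣ ∎
    where
    open ℚ.≤-Reasoning
    open +-*-Solver

  ∣∣p∣-∣q∣∣≤∣p-q∣ : ∀ p q → ℚ.∣ ℚ.∣ p ∣ ℚ.- ℚ.∣ q ∣ ∣ ℚ.≤ ℚ.∣ p ℚ.- q ∣
  ∣∣p∣-∣q∣∣≤∣p-q∣ p q = ∣p∣≤⇒ (∣p∣-∣q∣≤ p q)
    (subst₂ ℚ._≤_
      (solve 2 (λ a b → a :- b := :- (b :- a)) refl ℚ.∣ q ∣ ℚ.∣ p ∣)
      (∣p-q∣-sym q p) (∣p∣-∣q∣≤ q p))
    where
    open +-*-Solver

  EvBounded : (ℕ → ℚ) → Set
  EvBounded u = Σ[ B ∈ ℚ ] ℚ.Positive B × ∃[ N ] ∀ n → n ≥ N → ℚ.∣ u n ∣ ℚ.≤ B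

  0<1 : 0ℚ ℚ.< 1ℚ
  0<1 = ℚ.positive⁻¹ 1ℚ

  bounded : ∀ {u} → Cauchy u → EvBounded u
  bounded {u} c with c 1ℚ 0<1
  ... | N , h = ℚ.∣ u N ∣ ℚ.+ 1ℚ
              , ℚ.nonNeg+pos⇒pos ℚ.∣ u N ∣ {{ℚ.∣-∣-nonNeg (u N)}} 1ℚ
              , N , λ n n≥N → begin
    ℚ.∣ u n ∣
      ≡⟨ cong ℚ.∣_∣ (solve 2 (λ a b → a := b :+ (a :- b)) refl (u n) (u N)) ⟩
    ℚ.∣ u N ℚ.+ (u n ℚ.- u N) ∣
      ≤⟨ ℚ.∣p+q∣≤∣p∣+∣q∣ (u N) _ ⟩
    ℚ.∣ u N ∣ ℚ.+ ℚ.∣ u n ℚ.- u N ∣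
      ≤⟨ ℚ.+-monoʳ-≤ ℚ.∣ u N ∣ (ℚ.<⇒≤ (h n N n≥N ℕ.≤-refl)) ⟩
    ℚ.∣ u N ∣ ℚ.+ 1ℚ ∎
    where
    open ℚ.≤-Reasoning
    open +-*-Solver

  -- δ with B * δ = ε
  divide : ∀ ε B → 0ℚ ℚ.< ε → ℚ.Positive B → Σ[ δ ∈ ℚ ] 0ℚ ℚ.< δ × B ℚ.* δ ≡ ε
  divide ε B 0<ε B>0 = 1/B ℚ.* ε , 0<δ , eq
    where
    instance
      _ = ℚ.pos⇒nonZero B {{B>0}}
    1/B = ℚ.1/ B
    0<δ : 0ℚ ℚ.< 1/B ℚ.* ε
    0<δ = subst (ℚ._< 1/B ℚ.* ε) (ℚ.*-zeroʳ 1/B)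
            (ℚ.*-monoʳ-<-pos 1/B {{ℚ.1/pos⇒pos B {{B>0}}}} 0<ε)
    eq : B ℚ.* (1/B ℚ.* ε) ≡ ε
    eq = trans (sym (ℚ.*-assoc B 1/B ε))
           (trans (cong (ℚ._* ε) (ℚ.*-inverseʳ B)) (ℚ.*-identityˡ ε))

  bound* : ∀ {B δ ε p q} → ℚ.Positive B → B ℚ.* δ ≡ ε →
           ℚ.∣ p ∣ ℚ.≤ B → ℚ.∣ q ∣ ℚ.< δ → ℚ.∣ p ℚ.* q ∣ ℚ.< ε
  bound* {B} {δ} {ε} {p} {q} B>0 e pB qδ = begin-strict
    ℚ.∣ p ℚ.* q ∣        ≡⟨ ℚ.∣p*q∣≡∣p∣*∣q∣ p q ⟩
    ℚ.∣ p ∣ ℚ.* ℚ.∣ q ∣  ≤⟨ ℚ.*-monoʳ-≤-nonNeg ℚ.∣ q ∣ {{ℚ.∣-∣-nonNeg q}} pB ⟩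
    B ℚ.* ℚ.∣ q ∣        <⟨ ℚ.*-monoʳ-<-pos B {{B>0}} qδ ⟩
    B ℚ.* δ              ≡⟨ e ⟩
    ε                    ∎
    where
    open ℚ.≤-Reasoning

  bound+ : ∀ {ε p q} → ℚ.∣ p ∣ ℚ.< ε ℚ.* ½ → ℚ.∣ q ∣ ℚ.< ε ℚ.* ½ → ℚ.∣ p ℚ.+ q ∣ ℚ.< ε
  bound+ {ε} {p} {q} a b = begin-strict
    ℚ.∣ p ℚ.+ q ∣         ≤⟨ ℚ.∣p+q∣≤∣p∣+∣q∣ p q ⟩
    ℚ.∣ p ∣ ℚ.+ ℚ.∣ q ∣   <⟨ ℚ.+-mono-< a b ⟩
    ε ℚ.* ½ ℚ.+ ε ℚ.* ½   ≡⟨ half+half ε ⟩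
    ε                     ∎
    where
    open ℚ.≤-Reasoning

  null-ext : ∀ {u v} → (∀ n → u n ≡ v n) → Null u → Null v
  null-ext e h ε 0<ε with h ε 0<ε
  ... | N , k = N , λ n n≥N → subst (λ z → ℚ.∣ z ∣ ℚ.< ε) (e n) (k n n≥N)

  null-0 : Null (λ _ → 0ℚ)
  null-0 ε 0<ε = 0 , λ _ _ → 0<ε

  null-+ : ∀ {u v} → Null u → Null v → Null (λ n → u n ℚ.+ v n)
  null-+ {u} {v} hu hv ε 0<ε with hu (ε ℚ.* ½) (half>0 0<ε) | hv (ε ℚ.* ½) (half>0 0<ε)
  ... | M , a | N , b = M ℕ.⊔ N , λ n h →
    bound+ {ε} {u n} {v n} (a n (N⊔₁ {M} h)) (b n (N⊔₂ {M} h))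

  null-neg : ∀ {u} → Null u → Null (λ n → ℚ.- u n)
  null-neg {u} hu ε 0<ε with hu ε 0<ε
  ... | N , k = N , λ n n≥N → subst (ℚ._< ε) (sym (ℚ.∣-p∣≡∣p∣ (u n))) (k n n≥N)

  null-* : ∀ {u v} → EvBounded u → Null v → Null (λ n → u n ℚ.* v n)
  null-* {u} {v} (B , B>0 , M , a) hv ε 0<ε with divide ε B 0<ε B>0
  ... | δ , 0<δ , e with hv δ 0<δ
  ... | N , b = M ℕ.⊔ N , λ n h →
    bound* {p = u n} {q = v n} B>0 e (a n (N⊔₁ {M} h)) (b n (N⊔₂ {M} h))

  cauchy-+ : ∀ {u v} → Cauchy u → Cauchy v → Cauchy (λ n → u n ℚ.+ v n)
  cauchy-+ {u} {v} cu cv ε 0<ε with cu (ε ℚ.* ½) (half>0 0<ε) | cv (ε ℚ.* ½) (half>0 0<ε)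
  ... | M , a | N , b = M ℕ.⊔ N , λ m n h k →
    subst (λ z → ℚ.∣ z ∣ ℚ.< ε)
      (solve 4 (λ a b c d → (a :- b) :+ (c :- d) := (a :+ c) :- (b :+ d)) refl
        (u m) (u n) (v m) (v n))
      (bound+ {ε} {u m ℚ.- u n} {v m ℚ.- v n}
        (a m n (N⊔₁ {M} h) (N⊔₁ {M} k)) (b m n (N⊔₂ {M} h) (N⊔₂ {M} k)))
    where
    open +-*-Solver

  cauchy-neg : ∀ {u} → Cauchy u → Cauchy (λ n → ℚ.- u n)
  cauchy-neg {u} cu ε 0<ε with cu ε 0<ε
  ... | N , a = N , λ m n h k → subst (ℚ._< ε)
    (trans (sym (ℚ.∣-p∣≡∣p∣ (u m ℚ.- u n)))
      (cong ℚ.∣_∣ (solve 2 (λ a b → :- (a :- b) := :- a :- :- b) refl (u m) (u n))))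
    (a m n h k)
    where
    open +-*-Solver

  *-difference : ∀ a b c d → a ℚ.* (c ℚ.- d) ℚ.+ d ℚ.* (a ℚ.- b) ≡ a ℚ.* c ℚ.- b ℚ.* d
  *-difference = solve 4 (λ a b c d → a :* (c :- d) :+ d :* (a :- b) := a :* c :- b :* d) refl
    where
    open +-*-Solver

  cauchy-* : ∀ {u v} → Cauchy u → Cauchy v → Cauchy (λ n → u n ℚ.* v n)
  cauchy-* {u} {v} cu cv ε 0<ε =
    N , λ m n h k → subst (λ z → ℚ.∣ z ∣ ℚ.< ε) (*-difference (u m) (u n) (v m) (v n))
      (bound+ {ε} {u m ℚ.* (v m ℚ.- v n)} {v n ℚ.* (u m ℚ.- u n)}
        (vary {u} {v} bu cv′ m m n (N⊔₁ {Nᵤ} h) (N⊔₁ {Nᵤ} h) (N⊔₁ {Nᵤ} k))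
        (vary {v} {u} bv cu′ n m n (N⊔₂ {Nᵤ} k) (N⊔₂ {Nᵤ} h) (N⊔₂ {Nᵤ} k)))
    where
    η : ℚ
    η = ε ℚ.* ½

    Modulus : ℚ → (ℕ → ℚ) → Set
    Modulus δ w = ∃[ M ] ∀ m n → m ≥ M → n ≥ M → ℚ.∣ w m ℚ.- w n ∣ ℚ.< δ

    modulus : ∀ {w z} → (b : EvBounded w) → Cauchy z →
              Σ[ δ ∈ ℚ ] proj₁ b ℚ.* δ ≡ η × Modulus δ z
    modulus (B , B>0 , _) cz =
      let δ , 0<δ , e = divide η B (half>0 0<ε) B>0 in δ , e , cz δ 0<δ

    bu = bounded {u} cu
    bv = bounded {v} cv
    cv′ = modulus {u} {v} bu cv
    cu′ = modulus {v} {u} bv cu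

    index : ∀ {w z} (b : EvBounded w) → Σ[ δ ∈ ℚ ] proj₁ b ℚ.* δ ≡ η × Modulus δ z → ℕ
    index (_ , _ , M , _) (_ , _ , M′ , _) = M ℕ.⊔ M′

    Nᵤ = index {u} {v} bu cv′
    N  = Nᵤ ℕ.⊔ index {v} {u} bv cu′

    vary : ∀ {w z} (b : EvBounded w) (c : Σ[ δ ∈ ℚ ] proj₁ b ℚ.* δ ≡ η × Modulus δ z) →
           ∀ l m n → l ≥ index {w} {z} b c → m ≥ index {w} {z} b c → n ≥ index {w} {z} b c →
           ℚ.∣ w l ℚ.* (z m ℚ.- z n) ∣ ℚ.< η
    vary {w} {z} (B , B>0 , M , p) (δ , e , M′ , q) l m n g h k =
      bound* {p = w l} {q = z m ℚ.- z n} B>0 e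
        (p l (N⊔₁ {M} g)) (q m n (N⊔₂ {M} h) (N⊔₂ {M} k))

  cauchy-abs : ∀ {u} → Cauchy u → Cauchy (λ n → ℚ.∣ u n ∣)
  cauchy-abs {u} cu ε 0<ε with cu ε 0<ε
  ... | N , a = N , λ m n h k → ℚ.≤-<-trans (∣∣p∣-∣q∣∣≤∣p-q∣ (u m) (u n)) (a m n h k)

fromℚ : ℚ → ℝ
fromℚ q .seq    _     = q
fromℚ q .cauchy ε 0<ε = 0 , λ _ _ _ _ →
  subst (λ z → ℚ.∣ z ∣ ℚ.< ε) (sym (ℚ.+-inverseʳ q)) 0<ε

fromℤ : ℤ → ℝ
fromℤ k = fromℚ (k ℚ./ 1)

infixl 6 _+ᴿ_
infixl 7 _*ᴿ_
infix  8 -ᴿ_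

_+ᴿ_ : ℝ → ℝ → ℝ
(x +ᴿ y) .seq n  = seq x n ℚ.+ seq y n
(x +ᴿ y) .cauchy = cauchy-+ {seq x} {seq y} (cauchy x) (cauchy y)

_*ᴿ_ : ℝ → ℝ → ℝ
(x *ᴿ y) .seq n  = seq x n ℚ.* seq y n
(x *ᴿ y) .cauchy = cauchy-* {seq x} {seq y} (cauchy x) (cauchy y)

-ᴿ_ : ℝ → ℝ
(-ᴿ x) .seq n  = ℚ.- seq x n
(-ᴿ x) .cauchy = cauchy-neg {seq x} (cauchy x)

∣_∣ᴿ : ℝ → ℝ
∣ x ∣ᴿ .seq n  = ℚ.∣ seq x n ∣
∣ x ∣ᴿ .cauchy = cauchy-abs {seq x} (cauchy x)

0ᴿ 1ᴿ : ℝ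
0ᴿ = fromℚ 0ℚ
1ᴿ = fromℚ 1ℚ

pointwise : ∀ {x y} → (∀ n → seq x n ≡ seq y n) → x ≈ᴿ y
pointwise {x} {y} e = mk≈ (null-ext
  (λ n → sym (trans (cong (ℚ._- seq y n) (e n)) (ℚ.+-inverseʳ (seq y n)))) null-0)

private
  ≈-sym : ∀ {x y} → x ≈ᴿ y → y ≈ᴿ x
  ≈-sym {x} {y} (mk≈ h) = mk≈ (null-ext
    (λ n → solve 2 (λ a b → :- (a :- b) := b :- a) refl (seq x n) (seq y n))
    (null-neg {λ n → seq x n ℚ.- seq y n} h))
    where
    open +-*-Solver

  ≈-trans : ∀ {x y z} → x ≈ᴿ y → y ≈ᴿ z → x ≈ᴿ z
  ≈-trans {x} {y} {z} (mk≈ h) (mk≈ k) = mk≈ (null-ext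
    (λ n → solve 3 (λ a b c → (a :- b) :+ (b :- c) := a :- c) refl
             (seq x n) (seq y n) (seq z n))
    (null-+ {λ n → seq x n ℚ.- seq y n} {λ n → seq y n ℚ.- seq z n} h k))
    where
    open +-*-Solver

  +ᴿ-cong : ∀ {x y u v} → x ≈ᴿ y → u ≈ᴿ v → x +ᴿ u ≈ᴿ y +ᴿ v
  +ᴿ-cong {x} {y} {u} {v} (mk≈ h) (mk≈ k) = mk≈ (null-ext
    (λ n → solve 4 (λ a b c d → (a :- b) :+ (c :- d) := (a :+ c) :- (b :+ d)) refl
             (seq x n) (seq y n) (seq u n) (seq v n))
    (null-+ {λ n → seq x n ℚ.- seq y n} {λ n → seq u n ℚ.- seq v n} h k))
    where
    open +-*-Solver

  -ᴿ-cong : ∀ {x y} → x ≈ᴿ y → -ᴿ x ≈ᴿ -ᴿ y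
  -ᴿ-cong {x} {y} (mk≈ h) = mk≈ (null-ext
    (λ n → solve 2 (λ a b → :- (a :- b) := :- a :- :- b) refl (seq x n) (seq y n))
    (null-neg {λ n → seq x n ℚ.- seq y n} h))
    where
    open +-*-Solver

  *ᴿ-cong : ∀ {x y u v} → x ≈ᴿ y → u ≈ᴿ v → x *ᴿ u ≈ᴿ y *ᴿ v
  *ᴿ-cong {x} {y} {u} {v} (mk≈ h) (mk≈ k) = mk≈ (null-ext
    (λ n → solve 4 (λ a b c d → a :* (c :- d) :+ d :* (a :- b) := a :* c :- b :* d) refl
             (seq x n) (seq y n) (seq u n) (seq v n))
    (null-+ {λ n → seq x n ℚ.* (seq u n ℚ.- seq v n)} {λ n → seq v n ℚ.* (seq x n ℚ.- seq y n)}
      (null-* {seq x} {λ n → seq u n ℚ.- seq v n} (bounded {seq x} (cauchy x)) k)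
      (null-* {seq v} {λ n → seq x n ℚ.- seq y n} (bounded {seq v} (cauchy v)) h)))
    where
    open +-*-Solver

  ≈-refl : ∀ {x} → x ≈ᴿ x
  ≈-refl = pointwise λ _ → refl

  +ᴿ-assoc : ∀ x y z → (x +ᴿ y) +ᴿ z ≈ᴿ x +ᴿ (y +ᴿ z)
  +ᴿ-assoc x y z = pointwise λ n → ℚ.+-assoc (seq x n) (seq y n) (seq z n)

  +ᴿ-comm : ∀ x y → x +ᴿ y ≈ᴿ y +ᴿ x
  +ᴿ-comm x y = pointwise λ n → ℚ.+-comm (seq x n) (seq y n)

  +ᴿ-identityˡ : ∀ x → 0ᴿ +ᴿ x ≈ᴿ x
  +ᴿ-identityˡ x = pointwise λ n → ℚ.+-identityˡ (seq x n)

  +ᴿ-identityʳ : ∀ x → x +ᴿ 0ᴿ ≈ᴿ x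
  +ᴿ-identityʳ x = pointwise λ n → ℚ.+-identityʳ (seq x n)

  +ᴿ-inverseˡ : ∀ x → (-ᴿ x) +ᴿ x ≈ᴿ 0ᴿ
  +ᴿ-inverseˡ x = pointwise λ n → ℚ.+-inverseˡ (seq x n)

  +ᴿ-inverseʳ : ∀ x → x +ᴿ (-ᴿ x) ≈ᴿ 0ᴿ
  +ᴿ-inverseʳ x = pointwise λ n → ℚ.+-inverseʳ (seq x n)

  *ᴿ-assoc : ∀ x y z → (x *ᴿ y) *ᴿ z ≈ᴿ x *ᴿ (y *ᴿ z)
  *ᴿ-assoc x y z = pointwise λ n → ℚ.*-assoc (seq x n) (seq y n) (seq z n)

  *ᴿ-comm : ∀ x y → x *ᴿ y ≈ᴿ y *ᴿ x
  *ᴿ-comm x y = pointwise λ n → ℚ.*-comm (seq x n) (seq y n)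

  *ᴿ-identityˡ : ∀ x → 1ᴿ *ᴿ x ≈ᴿ x
  *ᴿ-identityˡ x = pointwise λ n → ℚ.*-identityˡ (seq x n)

  *ᴿ-identityʳ : ∀ x → x *ᴿ 1ᴿ ≈ᴿ x
  *ᴿ-identityʳ x = pointwise λ n → ℚ.*-identityʳ (seq x n)

  *ᴿ-distribˡ-+ᴿ : ∀ x y z → x *ᴿ (y +ᴿ z) ≈ᴿ x *ᴿ y +ᴿ x *ᴿ z
  *ᴿ-distribˡ-+ᴿ x y z = pointwise λ n → ℚ.*-distribˡ-+ (seq x n) (seq y n) (seq z n)

  *ᴿ-distribʳ-+ᴿ : ∀ x y z → (y +ᴿ z) *ᴿ x ≈ᴿ y *ᴿ x +ᴿ z *ᴿ x
  *ᴿ-distribʳ-+ᴿ x y z = pointwise λ n → ℚ.*-distribʳ-+ (seq x n) (seq y n) (seq z n)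

∣∣ᴿ-cong : ∀ {x y} → x ≈ᴿ y → ∣ x ∣ᴿ ≈ᴿ ∣ y ∣ᴿ
∣∣ᴿ-cong {x} {y} (mk≈ h) = mk≈ λ ε 0<ε → let N , k = h ε 0<ε in
  N , λ n n≥N → ℚ.≤-<-trans (∣∣p∣-∣q∣∣≤∣p-q∣ (seq x n) (seq y n)) (k n n≥N)

ℝ-commutativeRing : CommutativeRing 0ℓ 0ℓ
ℝ-commutativeRing = record
  { Carrier = ℝ ; _≈_ = _≈ᴿ_ ; _+_ = _+ᴿ_ ; _*_ = _*ᴿ_ ; -_ = -ᴿ_ ; 0# = 0ᴿ ; 1# = 1ᴿ
  ; isCommutativeRing = record
    { isRing = record
      { +-isAbelianGroup = record
        { isGroup = record
          { isMonoid = record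
            { isSemigroup = record
              { isMagma = record
                { isEquivalence = record { refl = ≈-refl ; sym = ≈-sym ; trans = ≈-trans }
                ; ∙-cong = +ᴿ-cong }
              ; assoc = +ᴿ-assoc }
            ; identity = +ᴿ-identityˡ , +ᴿ-identityʳ }
          ; inverse = +ᴿ-inverseˡ , +ᴿ-inverseʳ
          ; ⁻¹-cong = -ᴿ-cong }
        ; comm = +ᴿ-comm }
      ; *-cong = *ᴿ-cong
      ; *-assoc = *ᴿ-assoc
      ; *-identity = *ᴿ-identityˡ , *ᴿ-identityʳ
      ; distrib = *ᴿ-distribˡ-+ᴿ , *ᴿ-distribʳ-+ᴿ }
    ; *-comm = *ᴿ-comm } }

------------------------------------------------------------------------
-- Square matrices over a commutative ring

module Matrices {c ℓ} (R : CommutativeRing c ℓ) where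
  open CommutativeRing R hiding (zero)
  open Exp semiring using (_^_)
  open MonoidSum +-commutativeMonoid public using (sum)
  open MonoidSum *-commutativeMonoid public using () renaming (sum to product)

  Matrix : ℕ → Set c
  Matrix n = Fin n → Fin n → Carrier

  scalar : ∀ n → Carrier → Matrix n
  scalar n x i j = if does (i Fin.≟ j) then x else 0#

  -- Laplace expansion along the first row.
  det : ∀ {n} → Matrix n → Carrier
  det {zero}  A = 1#
  det {suc n} A = sum λ j →
    (- 1#) ^ toℕ j * (A zero j * det (λ r s → A (suc r) (punchIn j s)))

  charPoly : ∀ {n} → Matrix n → Carrier → Carrier
  charPoly {n} A x = det λ i j → scalar n x i j - A i j

  -- λs lists the eigenvalues of A with multiplicity: the characteristic
  -- polynomial of A is ∏ᵢ (x − λᵢ).  Over an infinite field such as ℝ,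
  -- identity of polynomials is identity of polynomial functions.
  AreEigenvalues : ∀ {n} → Matrix n → (Fin n → Carrier) → Set (c ⊔ ℓ)
  AreEigenvalues A λs = ∀ x → charPoly A x ≈ product λ i → x - λs i

open Matrices ℝ-commutativeRing

record Graph : Set₁ where
  field
    order     : ℕ
    _~_       : Rel (Fin order) 0ℓ
    _~?_      : Decidable _~_
    ~-sym     : Symmetric _~_
    ~-irrefl  : ∀ {v} → ¬ (v ~ v)

-- The graph whose vertices are the members of a duplicate-free list,
-- distinct vertices being adjacent when related by T.
graphOn : ∀ {A : Set} (xs : List A) → Unique xs → DecidableEquality A →
          (T : Rel A 0ℓ) → Decidable T → Symmetric T → Graph
graphOn xs _ _≟_ T T? T-sym = record
  { order    = length xs
  ; _~_      = (λ x y → x ≢ y × T x y) on lookup xs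
  ; _~?_     = λ i j → ¬? (lookup xs i ≟ lookup xs j) ×-dec T? (lookup xs i) (lookup xs j)
  ; ~-sym    = λ (x≢y , t) → (λ e → x≢y (sym e)) , T-sym t
  ; ~-irrefl = λ (x≢x , _) → x≢x refl
  }

adjacency : (G : Graph) → Matrix (Graph.order G)
adjacency G i j = if does (i ~? j) then 1ᴿ else 0ᴿ
  where
  open Graph G

-- e is the energy of G.  As eigenvalues are determined by the graph only
-- up to order (and _≈ᴿ_), energy is a relation rather than a function.
Energy : Graph → ℝ → Set
Energy G e = ∃[ λs ] AreEigenvalues (adjacency G) λs × e ≈ᴿ sum (λ i → ∣ λs i ∣ᴿ)

module _ (G : Graph) where
  open Graph G

  private
    V = Fin order

  -- An edge {u, v} is represented by the pair (u , v) with u < v.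
  IsEdge : Pred (V × V) 0ℓ
  IsEdge (u , v) = u Fin.< v × u ~ v

  isEdge? : U.Decidable IsEdge
  isEdge? (u , v) = (u Fin.<? v) ×-dec (u ~? v)

  edges : List (V × V)
  edges = filter isEdge? (cartesianProduct (allFin order) (allFin order))

  edges-unique : Unique edges
  edges-unique = Unique.filter⁺ isEdge?
    (Unique.cartesianProduct⁺ (Unique.allFin⁺ order) (Unique.allFin⁺ order))

  _EndpointOf_ : V → V × V → Set
  w EndpointOf (u , v) = w ≡ u ⊎ w ≡ v

  ShareVertex : Rel (V × V) 0ℓ
  ShareVertex e f = ∃[ w ] w EndpointOf e × w EndpointOf f

  shareVertex? : Decidable ShareVertex
  shareVertex? (a , b) (c , d) = any? λ w →
    ((w Fin.≟ a) ⊎-dec (w Fin.≟ b)) ×-dec ((w Fin.≟ c) ⊎-dec (w Fin.≟ d))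

  lineGraph : Graph
  lineGraph = graphOn edges edges-unique (≡-dec Fin._≟_ Fin._≟_)
    ShareVertex shareVertex? λ (w , p , q) → w , q , p

------------------------------------------------------------------------
-- The zero-divisor graph of ℤₙ, whose elements are the residues in Fin n

module _ {n : ℕ} where

  infixl 7 _*ₙ_

  _*ₙ_ : Fin n → Fin n → Fin n
  x *ₙ y = (_mod_ (toℕ x ℕ.* toℕ y) n) {{nonZeroIndex x}}

  IsZero : Pred (Fin n) 0ℓ
  IsZero x = toℕ x ≡ 0

  isZero? : U.Decidable IsZero
  isZero? x = toℕ x ℕ.≟ 0

  IsNonzeroZeroDivisor : Pred (Fin n) 0ℓ
  IsNonzeroZeroDivisor x = ¬ IsZero x × ∃[ y ] ¬ IsZero y × IsZero (x *ₙ y)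

  isNonzeroZeroDivisor? : U.Decidable IsNonzeroZeroDivisor
  isNonzeroZeroDivisor? x =
    ¬? (isZero? x) ×-dec any? λ y → ¬? (isZero? y) ×-dec isZero? (x *ₙ y)

  *ₙ-comm : ∀ x y → x *ₙ y ≡ y *ₙ x
  *ₙ-comm x y = cong (λ k → (k mod n) {{nonZeroIndex x}}) (ℕ.*-comm (toℕ x) (toℕ y))

zeroDivisors : (n : ℕ) → List (Fin n)
zeroDivisors n = filter isNonzeroZeroDivisor? (allFin n)

zeroDivisorGraph : ℕ → Graph
zeroDivisorGraph n = graphOn (zeroDivisors n)
  (Unique.filter⁺ isNonzeroZeroDivisor? (Unique.allFin⁺ n)) Fin._≟_
  (λ x y → IsZero (x *ₙ y)) (λ x y → isZero? (x *ₙ y))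
  λ {x} {y} → subst IsZero (*ₙ-comm x y)

{-# OPTIONS --safe #-}
module Submission where

-- The nonzero zero-divisors of ℤ_{p²} are the p − 1 nonzero multiples of p, and
-- any two of them multiply to 0, so Γ(ℤ_{p²}) is the complete graph K_m with
-- m = p − 1.  Put y = x + 2.  The row of xI − A(L(K_m)) at the edge {u, v} is
-- y δ_{uv} − β_u − β_v, where δ_{uv} is the unit vector of the edge {u, v} and
-- β_u the sum of the unit vectors of the edges at u.  Let
-- γ_{ij} = δ_{ij} − δ_{0i} − δ_{0j} for i, j ≥ 1 and κ = γ_{12}.  Division-free
-- row operations turn these rows into
--   (y − (m − 2)) (δ_{0i} + κ),   (y − 2 (m − 1)) κ,   y (γ_{ij} − κ),
-- and once the scalars are pulled out, further row operations lead to the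
-- identity matrix.  Hence the eigenvalues are m − 4 (m − 1 times), 2 (m − 2)
-- (once) and −2 (on the remaining edges), and the energy is
-- 2 m (m − 3) = 2 p² − 10 p + 8.

open import Defs
open import Algebra.Bundles using (CommutativeRing)
import Algebra.Properties.AbelianGroup as AbelianGroupProperties
import Algebra.Properties.CommutativeMonoid.Sum as MonoidSum
import Algebra.Properties.Ring as RingProperties
import Algebra.Properties.Semiring.Exp as Exp
import Algebra.Properties.Semiring.Mult.TCOptimised as Mult
import Algebra.Properties.Semiring.Sum as SemiringSum
import Algebra.Solver.Ring as RingSolver
open import Algebra.Solver.Ring.AlmostCommutativeRing
  using (fromCommutativeRing; _-Raw-AlmostCommutative⟶_)
open import Data.Bool.Base using (if_then_else_; true; false)
open import Data.Empty using (⊥; ⊥-elim)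
open import Data.Fin.Base as Fin using (Fin; zero; suc; toℕ; fromℕ<; punchIn)
import Data.Fin.Properties as Fin
open import Data.Integer.Base as ℤ using (ℤ; +_; -[1+_]; _⊖_)
import Data.Integer.Properties as ℤ
import Data.Integer.Solver as ℤSolver
open import Data.List.Base
  using (List; []; _∷_; _++_; map; filter; tabulate; allFin; cartesianProduct; lookup)
open import Data.List.Membership.Propositional using (_∈_)
open import Data.List.Membership.Propositional.Properties
  using (∈-lookup; ∈-filter⁺; ∈-filter⁻; ∈-cartesianProduct⁺; ∈-allFin; ∈-tabulate⁺; ∈-tabulate⁻)
open import Data.List.Membership.Propositional.Properties.WithK using (unique∧set⇒bag)
import Data.List.Properties as List
open import Data.List.Relation.Binary.BagAndSetEquality using (∼bag⇒↭)
open import Data.List.Relation.Binary.Permutation.Propositional.Properties using (↭-length)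
import Data.List.Relation.Unary.All as All
open import Data.List.Relation.Unary.AllPairs using (_∷_)
import Data.List.Relation.Unary.Any as Any
open import Data.List.Relation.Unary.Any.Properties using (lookup-index)
open import Data.List.Relation.Unary.Unique.Propositional using (Unique)
import Data.List.Relation.Unary.Unique.Propositional.Properties as Unique
import Data.Maybe.Base as Maybe
open import Data.Nat.Base as ℕ using (ℕ; zero; suc; _≤_; _^_; z≤n; s≤s; _<ᵇ_)
open import Data.Nat.Divisibility
  using (_∣_; divides; ∣-trans; ∣⇒≤; m∣m*n; m%n≡0⇒n∣m; n∣m⇒m%n≡0; *-cancelˡ-∣; *-monoˡ-∣; *-pres-∣)
open import Data.Nat.DivMod using (m%n<n)
open import Data.Nat.ListAction using () renaming (sum to sumℕ)
open import Data.Nat.ListAction.Properties using (sum-++)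
open import Data.Nat.Primality using (Prime; euclidsLemma)
import Data.Nat.Properties as ℕ
import Data.Nat.Solver as ℕSolver
open import Data.Product.Base using (∃-syntax; _×_; _,_; proj₁; proj₂)
import Data.Rational.Base as ℚ
import Data.Rational.Properties as ℚ
import Data.Rational.Unnormalised.Base as ℚᵘ
import Data.Rational.Unnormalised.Properties as ℚᵘ
open import Data.Sum.Base using (_⊎_; inj₁; inj₂)
open import Data.Unit.Base using (⊤; tt)
open import Function.Base using (_∘_; id)
open import Function.Bundles using (mk⇔)
open import Level using (0ℓ; _⊔_)
open import Relation.Binary.Definitions using (tri<; tri≈; tri>)
open import Relation.Binary.PropositionalEquality as ≡ using (_≡_; _≢_; module ≡-Reasoning)
import Relation.Binary.Reasoning.Setoid as SetoidReasoning
open import Relation.Nullary.Decidable using (Dec; does; yes; no; dec⇒maybe; _×-dec_)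
open import Relation.Nullary.Negation using (¬_)
open import Relation.Unary as U using (Pred)

-- Write B for the map δ_{uv} ↦ β_u + β_v, so that the rows are those of y - B. The scalars come
-- from a flag of subspaces, not from eigenvectors. For distinct i, j ≥ 1, B γ_{ij} = -2 β_0
-- whatever i and j are, so B kills γ_{ij} - κ. Next, B (δ_{0i} + κ) = β_i - β_0, which is (m - 2)
-- (δ_{0i} + κ) plus the sum of γ_{ij} - κ over j ≠ i. Modulo all these vectors δ_{0i} ≡ -κ, so β_0,
-- the sum of the δ_{0i}, is ≡ -(m - 1) κ, and B κ = -2 β_0 ≡ 2 (m - 1) κ.
--
-- Division is the obstacle: the factorisation is demanded at every real `x`, where `y` may vanish,
-- and no case split on an equality of reals is available. So a scalar is pulled out of the rows of
-- one kind before these rows clear others: the γ_{ij} - κ can be added to the star rows only once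
-- their factor y is gone.

-- A ring solver with integer coefficients over any commutative ring

module IntegerCoefficients {c ℓ} (R : CommutativeRing c ℓ) where
  open CommutativeRing R hiding (zero)
  open Mult semiring renaming (_×_ to _×′_)
  open RingProperties ring
  open AbelianGroupProperties +-abelianGroup using (⁻¹-∙-comm)
  open SetoidReasoning setoid

  -- The solver must decide equality of coefficients, which is possible in ℤ but not in the reals.
  -- With this form of `_×′_`, `int (+ 1)` reduces to `1#`, so `con (+ 1)` in a solver call matches
  -- `1#` in the goal.
  int : ℤ → Carrier
  int (+ n)    = n ×′ 1#
  int -[1+ n ] = - (suc n ×′ 1#)

  private
    int-neg : ∀ i → int (ℤ.- i) ≈ - int i
    int-neg (+ zero)  = sym -0#≈0#
    int-neg (+ suc n) = refl
    int-neg -[1+ n ]  = sym (-‿involutive _)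

    cancel : ∀ x a b → (x + a) - (x + b) ≈ a - b
    cancel x a b = begin
      (x + a) - (x + b)      ≈⟨ +-cong (+-comm x a) (sym (⁻¹-∙-comm x b)) ⟩
      (a + x) + (- x - b)    ≈⟨ +-assoc a x _ ⟩
      a + (x + (- x - b))    ≈⟨ +-congˡ (+-assoc x (- x) (- b)) ⟨
      a + ((x - x) - b)      ≈⟨ +-congˡ (+-congʳ (-‿inverseʳ x)) ⟩
      a + (0# - b)           ≈⟨ +-congˡ (+-identityˡ _) ⟩
      a - b                  ∎

    int-⊖ : ∀ m n → int (m ⊖ n) ≈ m ×′ 1# - n ×′ 1#
    int-⊖ zero    zero    = sym (-‿inverseʳ 0#)
    int-⊖ zero    (suc n) = sym (+-identityˡ _)
    int-⊖ (suc m) zero    = sym (trans (+-congˡ -0#≈0#) (+-identityʳ _))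
    int-⊖ (suc m) (suc n) = begin
      int (suc m ⊖ suc n)                ≡⟨ ≡.cong int (ℤ.[1+m]⊖[1+n]≡m⊖n m n) ⟩
      int (m ⊖ n)                        ≈⟨ int-⊖ m n ⟩
      m ×′ 1# - n ×′ 1#                    ≈⟨ cancel 1# _ _ ⟨
      (1# + m ×′ 1#) - (1# + n ×′ 1#)      ≈⟨ +-cong (1+× m 1#) (-‿cong (1+× n 1#)) ⟨
      suc m ×′ 1# - suc n ×′ 1#            ∎

  int-+ : ∀ i j → int (i ℤ.+ j) ≈ int i + int j
  int-+ (+ m)    (+ n)    = ×-homo-+ 1# m n
  int-+ (+ m)    -[1+ n ] = int-⊖ m (suc n)
  int-+ -[1+ m ] (+ n)    = trans (int-⊖ n (suc m)) (+-comm _ _)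
  int-+ -[1+ m ] -[1+ n ] = begin
    - (suc (suc (m ℕ.+ n)) ×′ 1#)        ≡⟨ ≡.cong (λ k → - (k ×′ 1#)) (ℕ.+-suc (suc m) n) ⟨
    - ((suc m ℕ.+ suc n) ×′ 1#)          ≈⟨ -‿cong (×-homo-+ 1# (suc m) (suc n)) ⟩
    - (suc m ×′ 1# + suc n ×′ 1#)         ≈⟨ ⁻¹-∙-comm _ _ ⟨
    - (suc m ×′ 1#) - suc n ×′ 1#         ∎

  private
    int-+*+ : ∀ m n → int (+ m ℤ.* + n) ≈ m ×′ 1# * n ×′ 1#
    int-+*+ m n = begin
      int (+ m ℤ.* + n)  ≡⟨ ≡.cong int (≡.sym (ℤ.pos-* m n)) ⟩
      (m ℕ.* n) ×′ 1#     ≈⟨ ×1-homo-* m n ⟩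
      m ×′ 1# * n ×′ 1#    ∎

    int-+* : ∀ m j → int (+ m ℤ.* j) ≈ m ×′ 1# * int j
    int-+* m (+ n)    = int-+*+ m n
    int-+* m -[1+ n ] = begin
      int (+ m ℤ.* (ℤ.- + suc n))  ≡⟨ ≡.cong int (≡.sym (ℤ.neg-distribʳ-* (+ m) (+ suc n))) ⟩
      int (ℤ.- (+ m ℤ.* + suc n))  ≈⟨ int-neg (+ m ℤ.* + suc n) ⟩
      - int (+ m ℤ.* + suc n)      ≈⟨ -‿cong (int-+*+ m (suc n)) ⟩
      - (m ×′ 1# * suc n ×′ 1#)      ≈⟨ -‿distribʳ-* _ _ ⟩
      m ×′ 1# * - (suc n ×′ 1#)      ∎

    int-* : ∀ i j → int (i ℤ.* j) ≈ int i * int j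
    int-* (+ m)    j = int-+* m j
    int-* -[1+ m ] j = begin
      int ((ℤ.- + suc m) ℤ.* j)    ≡⟨ ≡.cong int (≡.sym (ℤ.neg-distribˡ-* (+ suc m) j)) ⟩
      int (ℤ.- (+ suc m ℤ.* j))    ≈⟨ int-neg (+ suc m ℤ.* j) ⟩
      - int (+ suc m ℤ.* j)        ≈⟨ -‿cong (int-+* (suc m) j) ⟩
      - (suc m ×′ 1# * int j)       ≈⟨ -‿distribˡ-* _ _ ⟩
      - (suc m ×′ 1#) * int j       ∎

    morphism : ℤ.+-*-rawRing -Raw-AlmostCommutative⟶ fromCommutativeRing R
    morphism = record
      { ⟦_⟧ = int ; +-homo = int-+ ; *-homo = int-* ; -‿homo = int-neg
      ; 0-homo = refl ; 1-homo = refl }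

  open RingSolver ℤ.+-*-rawRing (fromCommutativeRing R) morphism
    (λ i j → Maybe.map (λ e → reflexive (≡.cong int e)) (dec⇒maybe (i ℤ.≟ j))) public
    using (solve; _:=_; _:+_; _:*_; _:-_; :-_; con)

-- Determinants by Laplace expansion: multilinear, alternating, invariant under row operations

module Determinants {c ℓ} (R : CommutativeRing c ℓ) where
  open CommutativeRing R hiding (zero)
  open Matrices R
  open IntegerCoefficients R
  open Exp semiring using () renaming (_^_ to _↑_)
  open MonoidSum +-commutativeMonoid using (sum-cong-≋; ∑-distrib-+; sum-replicate-zero)
  open SemiringSum semiring using (*-distribˡ-sum)
  open SetoidReasoning setoid

  Row : ℕ → Set c
  Row n = Fin n → Carrier

  infix 4 _≋_
  _≋_ : ∀ {n} → Row n → Row n → Set ℓ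
  v ≋ w = ∀ j → v j ≈ w j

  minor : ∀ {n} → Matrix (suc n) → Fin (suc n) → Matrix n
  minor A j r s = A (suc r) (punchIn j s)

  sgn : ∀ {n} → Fin n → Carrier
  sgn j = (- 1#) ↑ toℕ j

  laplace : ∀ {n} → Matrix (suc n) → Row (suc n)
  laplace A j = sgn j * (A zero j * det (minor A j))

  -- Opaque, as otherwise unification unfolds sums over Fin (suc n).
  opaque
    ∑ : ∀ {n} → Row n → Carrier
    ∑ = sum

    ∑≈sum : ∀ {n} (v : Row n) → ∑ v ≈ sum v
    ∑≈sum v = refl

    ∑-cong : ∀ {n} {v w : Row n} → v ≋ w → ∑ v ≈ ∑ w
    ∑-cong = sum-cong-≋

    ∑-+ : ∀ {n} (v w : Row n) → ∑ (λ j → v j + w j) ≈ ∑ v + ∑ w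
    ∑-+ = ∑-distrib-+

    ∑-* : ∀ {n} k (v : Row n) → k * ∑ v ≈ ∑ (λ j → k * v j)
    ∑-* = *-distribˡ-sum

    ∑-empty : (v : Row 0) → ∑ v ≈ 0#
    ∑-empty v = refl

    ∑-suc : ∀ {n} (v : Row (suc n)) → ∑ v ≈ v zero + ∑ (v ∘ suc)
    ∑-suc v = refl

    det-expand : ∀ {n} (A : Matrix (suc n)) → det A ≈ ∑ (laplace A)
    det-expand A = refl

  ∑-zero : ∀ {n} {v : Row n} → (∀ j → v j ≈ 0#) → ∑ v ≈ 0#
  ∑-zero {zero}      h = ∑-empty _
  ∑-zero {suc n} {v} h = trans (∑-suc v) (trans (+-cong (h zero) (∑-zero (h ∘ suc))) (+-identityˡ 0#))

  AgreeOff : ∀ {n} → Fin n → Matrix n → Matrix n → Set ℓ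
  AgreeOff i A B = ∀ r → r ≢ i → A r ≋ B r

  private
    off-suc : ∀ {n} {A B : Matrix (suc n)} {i} → AgreeOff (suc i) A B →
              ∀ j → AgreeOff i (minor A j) (minor B j)
    off-suc h j r r≢i s = h (suc r) (λ e → r≢i (Fin.suc-injective e)) (punchIn j s)

  det-cong : ∀ {n} {A B : Matrix n} → (∀ i → A i ≋ B i) → det A ≈ det B
  det-cong {zero}          h = refl
  det-cong {suc n} {A} {B} h = begin
    det A            ≈⟨ det-expand A ⟩
    ∑ (laplace A)    ≈⟨ ∑-cong (λ j → *-congˡ (*-cong (h zero j)
                          (det-cong λ r s → h (suc r) (punchIn j s)))) ⟩
    ∑ (laplace B)    ≈⟨ det-expand B ⟨
    det B            ∎

  private
    laplace-additive : ∀ {n} {A B C : Matrix (suc n)} →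
      (∀ j → laplace C j ≈ laplace A j + laplace B j) → det C ≈ det A + det B
    laplace-additive {A = A} {B} {C} h = begin
      det C                                 ≈⟨ det-expand C ⟩
      ∑ (laplace C)                         ≈⟨ ∑-cong h ⟩
      ∑ (λ j → laplace A j + laplace B j)   ≈⟨ ∑-+ (laplace A) (laplace B) ⟩
      ∑ (laplace A) + ∑ (laplace B)         ≈⟨ +-cong (det-expand A) (det-expand B) ⟨
      det A + det B                         ∎

    laplace-homogeneous : ∀ {n} k {A C : Matrix (suc n)} →
      (∀ j → laplace C j ≈ k * laplace A j) → det C ≈ k * det A
    laplace-homogeneous k {A} {C} h = begin
      det C                      ≈⟨ det-expand C ⟩
      ∑ (laplace C)              ≈⟨ ∑-cong h ⟩
      ∑ (λ j → k * laplace A j)  ≈⟨ ∑-* k (laplace A) ⟨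
      k * ∑ (laplace A)          ≈⟨ *-congˡ (det-expand A) ⟨
      k * det A                  ∎

  det-additive : ∀ {n} i {A B C : Matrix n} → AgreeOff i A C → AgreeOff i B C →
                 (∀ s → C i s ≈ A i s + B i s) → det C ≈ det A + det B
  det-additive zero {A} {B} {C} hA hB e = laplace-additive {A = A} {B} {C} λ j →
      let D = det (minor C j) in begin
      sgn j * (C zero j * D)
        ≈⟨ *-congˡ (*-congʳ (e j)) ⟩
      sgn j * ((A zero j + B zero j) * D)
        ≈⟨ solve 4 (λ s a b d → s :* ((a :+ b) :* d) := s :* (a :* d) :+ s :* (b :* d))
             refl _ _ _ _ ⟩
      sgn j * (A zero j * D) + sgn j * (B zero j * D)
        ≈⟨ +-cong (*-congˡ (*-congˡ (det-cong λ r s → hA (suc r) (λ ()) (punchIn j s))))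
                  (*-congˡ (*-congˡ (det-cong λ r s → hB (suc r) (λ ()) (punchIn j s)))) ⟨
      sgn j * (A zero j * det (minor A j)) + sgn j * (B zero j * det (minor B j)) ∎
  det-additive (suc i) {A} {B} {C} hA hB e = laplace-additive {A = A} {B} {C} λ j → begin
      sgn j * (C zero j * det (minor C j))
        ≈⟨ *-congˡ (*-congˡ (det-additive i (off-suc hA j) (off-suc hB j) (e ∘ punchIn j))) ⟩
      sgn j * (C zero j * (det (minor A j) + det (minor B j)))
        ≈⟨ solve 4 (λ s a d d′ → s :* (a :* (d :+ d′)) := s :* (a :* d) :+ s :* (a :* d′))
             refl _ _ _ _ ⟩
      sgn j * (C zero j * det (minor A j)) + sgn j * (C zero j * det (minor B j))
        ≈⟨ +-cong (*-congˡ (*-congʳ (hA zero (λ ()) j))) (*-congˡ (*-congʳ (hB zero (λ ()) j))) ⟨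
      sgn j * (A zero j * det (minor A j)) + sgn j * (B zero j * det (minor B j)) ∎

  det-homogeneous : ∀ {n} i k {A C : Matrix n} → AgreeOff i A C →
                    (∀ s → C i s ≈ k * A i s) → det C ≈ k * det A
  det-homogeneous zero k {A} {C} h e = laplace-homogeneous k {A} {C} λ j → begin
      sgn j * (C zero j * det (minor C j))
        ≈⟨ *-congˡ (*-cong (e j) (sym (det-cong λ r s → h (suc r) (λ ()) (punchIn j s)))) ⟩
      sgn j * ((k * A zero j) * det (minor A j))
        ≈⟨ solve 4 (λ s k a d → s :* ((k :* a) :* d) := k :* (s :* (a :* d))) refl _ _ _ _ ⟩
      k * (sgn j * (A zero j * det (minor A j))) ∎
  det-homogeneous (suc i) k {A} {C} h e = laplace-homogeneous k {A} {C} λ j → begin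
      sgn j * (C zero j * det (minor C j))
        ≈⟨ *-congˡ (*-cong (sym (h zero (λ ()) j))
             (det-homogeneous i k (off-suc h j) (e ∘ punchIn j))) ⟩
      sgn j * (A zero j * (k * det (minor A j)))
        ≈⟨ solve 4 (λ s a k d → s :* (a :* (k :* d)) := k :* (s :* (a :* d))) refl _ _ _ _ ⟩
      k * (sgn j * (A zero j * det (minor A j))) ∎

  det-scaleRows : ∀ {n} (d : Fin n → Carrier) {A C : Matrix n} →
                  (∀ i j → C i j ≈ d i * A i j) → det C ≈ product d * det A
  det-scaleRows {zero}  d         e = sym (*-identityˡ 1#)
  det-scaleRows {suc n} d {A} {C} e = laplace-homogeneous (d zero * product (d ∘ suc)) {A} {C} λ j → begin
      sgn j * (C zero j * det (minor C j))
        ≈⟨ *-congˡ (*-cong (e zero j)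
             (det-scaleRows (d ∘ suc) λ r s → e (suc r) (punchIn j s))) ⟩
      sgn j * ((d zero * A zero j) * (product (d ∘ suc) * det (minor A j)))
        ≈⟨ solve 5 (λ s k a p d → s :* ((k :* a) :* (p :* d)) := (k :* p) :* (s :* (a :* d)))
             refl _ _ _ _ _ ⟩
      (d zero * product (d ∘ suc)) * (sgn j * (A zero j * det (minor A j))) ∎

  det-identity : ∀ n → det (scalar n 1#) ≈ 1#
  det-identity zero    = refl
  det-identity (suc n) = begin
    det I
      ≈⟨ trans (det-expand I) (∑-suc (laplace I)) ⟩
    laplace I zero + ∑ (laplace I ∘ suc)
      ≈⟨ +-cong (*-congˡ (*-congˡ (det-identity n)))
           (∑-zero λ j → trans (*-congˡ (zeroˡ (det (minor I (suc j))))) (zeroʳ (sgn (suc j)))) ⟩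
    1# * (1# * 1#) + 0#
      ≈⟨ solve 0 (con (+ 1) :* (con (+ 1) :* con (+ 1)) :+ con (+ 0) := con (+ 1)) refl ⟩
    1# ∎
    where
    I = scalar (suc n) 1#

  private
    -- In a Laplace expansion along two rows, the columns (j , k) with j ≤ k and
    -- (suc k , j) select the same pair of columns, with opposite signs.
    pairTerm : ∀ {n} (w : Fin (2 ℕ.+ n) → Fin (2 ℕ.+ n) → Carrier)
      (D : (Fin n → Fin (2 ℕ.+ n)) → Carrier) → Fin (2 ℕ.+ n) → Fin (1 ℕ.+ n) → Carrier
    pairTerm w D j k = sgn j * (sgn k *
      (w j (punchIn j k) * D (punchIn j ∘ punchIn k)))

    lift : ∀ {m n} → (Fin m → Fin n) → Fin (suc m) → Fin (suc n)
    lift φ zero    = zero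
    lift φ (suc s) = suc (φ s)

    lift-cong : ∀ {m n} {φ ψ : Fin m → Fin n} → (∀ s → φ s ≡ ψ s) → ∀ s → lift φ s ≡ lift ψ s
    lift-cong h zero    = ≡.refl
    lift-cong h (suc s) = ≡.cong suc (h s)

    -- The terms (0 , k) and (suc k , 0) cancel because `w` is symmetric. In the terms (suc j , suc
    -- k) the two extra signs -1 cancel each other, and what is left is the same double sum for the
    -- shifted weight and `D ∘ lift`, one dimension lower. This is why `D` is an arbitrary function
    -- of the column selection; as selections are only compared pointwise, it comes with a
    -- congruence.
    pairs-cancel : ∀ n w (D : (Fin n → Fin (2 ℕ.+ n)) → Carrier) →
      (∀ j l → w j l ≈ w l j) → (∀ {φ ψ} → (∀ s → φ s ≡ ψ s) → D φ ≈ D ψ) →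
      ∑ (λ j → ∑ (pairTerm w D j)) ≈ 0#
    inner-cancel : ∀ n w (D : (Fin n → Fin (2 ℕ.+ n)) → Carrier) →
      (∀ j l → w j l ≈ w l j) → (∀ {φ ψ} → (∀ s → φ s ≡ ψ s) → D φ ≈ D ψ) →
      ∑ (λ j → ∑ (λ k → pairTerm w D (suc j) (suc k))) ≈ 0#

    pairs-cancel n w D w-sym D-cong = begin
      ∑ (λ j → ∑ (P j))
        ≈⟨ ∑-suc (λ j → ∑ (P j)) ⟩
      ∑ (P zero) + ∑ (λ j → ∑ (P (suc j)))
        ≈⟨ +-congˡ (trans (∑-cong λ j → ∑-suc (P (suc j))) (∑-+ (λ j → P (suc j) zero) _)) ⟩
      ∑ (P zero) + (∑ (λ j → P (suc j) zero) + ∑ (λ j → ∑ (λ k → P (suc j) (suc k))))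
        ≈⟨ +-congˡ (trans (+-congˡ (inner-cancel n w D w-sym D-cong)) (+-identityʳ _)) ⟩
      ∑ (P zero) + ∑ (λ j → P (suc j) zero)
        ≈⟨ ∑-+ (P zero) (λ j → P (suc j) zero) ⟨
      ∑ (λ k → P zero k + P (suc k) zero)
        ≈⟨ ∑-zero (λ k → trans (+-congˡ (*-congˡ (*-congˡ (*-congʳ (w-sym (suc k) zero)))))
             (solve 3 (λ s x d → con (+ 1) :* (s :* (x :* d)) :+
                                 (:- con (+ 1) :* s) :* (con (+ 1) :* (x :* d)) := con (+ 0))
               refl (sgn k) (w zero (suc k)) (D (λ s → suc (punchIn k s))))) ⟩
      0# ∎
      where
      P = pairTerm w D

    inner-cancel zero    w D w-sym D-cong = ∑-zero λ j → ∑-empty _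
    inner-cancel (suc n) w D w-sym D-cong = begin
      ∑ (λ j → ∑ (λ k → pairTerm w D (suc j) (suc k)))
        ≈⟨ (∑-cong λ j → ∑-cong λ k → trans
             (solve 3 (λ s t x → (:- con (+ 1) :* s) :* ((:- con (+ 1) :* t) :* x) := s :* (t :* x))
               refl (sgn j) (sgn k) _)
             (*-congˡ (*-congˡ (*-congˡ (D-cong λ { zero → ≡.refl ; (suc s) → ≡.refl }))))) ⟩
      ∑ (λ j → ∑ (pairTerm (λ a b → w (suc a) (suc b)) (D ∘ lift) j))
        ≈⟨ pairs-cancel n _ (D ∘ lift) (λ j l → w-sym (suc j) (suc l)) (D-cong ∘ lift-cong) ⟩
      0# ∎

    belowTwo : ∀ {n} → Matrix (2 ℕ.+ n) → (Fin n → Fin (2 ℕ.+ n)) → Carrier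
    belowTwo A φ = det λ r s → A (suc (suc r)) (φ s)

    belowTwo-cong : ∀ {n} (A : Matrix (2 ℕ.+ n)) {φ ψ} → (∀ s → φ s ≡ ψ s) →
                    belowTwo A φ ≈ belowTwo A ψ
    belowTwo-cong A h = det-cong λ r s → reflexive (≡.cong (A (suc (suc r))) (h s))

    expandTwo : ∀ {n} (A : Matrix (2 ℕ.+ n)) →
      det A ≈ ∑ (λ j → ∑ (pairTerm (λ j l → A zero j * A (suc zero) l) (belowTwo A) j))
    expandTwo {n} A = trans (det-expand A) (∑-cong λ j → begin
      sgn j * (A zero j * det (minor A j))
        ≈⟨ *-congˡ (*-congˡ (det-expand (minor A j))) ⟩
      sgn j * (A zero j * ∑ (laplace (minor A j)))
        ≈⟨ *-congˡ (∑-* (A zero j) (laplace (minor A j))) ⟩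
      sgn j * ∑ (λ k → A zero j * laplace (minor A j) k)
        ≈⟨ ∑-* (sgn j) (λ k → A zero j * laplace (minor A j) k) ⟩
      ∑ (λ k → sgn j * (A zero j * laplace (minor A j) k))
        ≈⟨ (∑-cong λ k → *-congˡ
             (solve 4 (λ a s b d → a :* (s :* (b :* d)) := s :* ((a :* b) :* d)) refl
               (A zero j) (sgn k) (A (suc zero) (punchIn j k)) _)) ⟩
      ∑ (pairTerm (λ j l → A zero j * A (suc zero) l) (belowTwo A) j) ∎)

    swap : ∀ {n} → Matrix (2 ℕ.+ n) → Matrix (2 ℕ.+ n)
    swap A zero          = A (suc zero)
    swap A (suc zero)    = A zero
    swap A (suc (suc r)) = A (suc (suc r))

    -- Both two-row expansions have the same lower minors, and the sum of their weights is symmetric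
    -- in the two columns, so `pairs-cancel` applies.
    det-swap : ∀ {n} (A : Matrix (2 ℕ.+ n)) → det A + det (swap A) ≈ 0#
    det-swap {n} A = begin
      det A + det (swap A)
        ≈⟨ +-cong (expandTwo A) (expandTwo (swap A)) ⟩
      ∑ (λ j → ∑ (P j)) + ∑ (λ j → ∑ (Q j))
        ≈⟨ ∑-+ (λ j → ∑ (P j)) (λ j → ∑ (Q j)) ⟨
      ∑ (λ j → ∑ (P j) + ∑ (Q j))
        ≈⟨ ∑-cong (λ j → trans (sym (∑-+ (P j) (Q j))) (∑-cong λ k →
             solve 5 (λ s t x y d → s :* (t :* (x :* d)) :+ s :* (t :* (y :* d))
                                  := s :* (t :* ((x :+ y) :* d))) refl
               (sgn j) (sgn k) (w j (punchIn j k)) (w′ j (punchIn j k)) _)) ⟩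
      ∑ (λ j → ∑ (pairTerm (λ j l → w j l + w′ j l) D j))
        ≈⟨ pairs-cancel n _ D (λ j l →
             solve 4 (λ a b c d → a :* b :+ c :* d := d :* c :+ b :* a) refl
               (A zero j) (A (suc zero) l) (A (suc zero) j) (A zero l))
             (belowTwo-cong A) ⟩
      0# ∎
      where
      D = belowTwo A
      w w′ : Fin (2 ℕ.+ n) → Fin (2 ℕ.+ n) → Carrier
      w j l  = A zero j * A (suc zero) l
      w′ j l = A (suc zero) j * A zero l
      P = pairTerm w D
      Q = pairTerm w′ D

  Alternating : ℕ → Set (c ⊔ ℓ)
  Alternating n = ∀ (A : Matrix n) i j → i ≢ j → A i ≋ A j → det A ≈ 0#

  private
    alternating-suc-suc : ∀ {n} → Alternating n → ∀ (A : Matrix (suc n)) i j → i ≢ j →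
                          A (suc i) ≋ A (suc j) → det A ≈ 0#
    alternating-suc-suc alt A i j i≢j e = trans (det-expand A) (∑-zero λ l → begin
      sgn l * (A zero l * det (minor A l))
        ≈⟨ *-congˡ (*-congˡ (alt (minor A l) i j i≢j (e ∘ punchIn l))) ⟩
      sgn l * (A zero l * 0#)
        ≈⟨ solve 2 (λ s a → s :* (a :* con (+ 0)) := con (+ 0)) refl (sgn l) (A zero l) ⟩
      0# ∎)

    -- If rows 0 and 1 agree, the weight in `expandTwo` is itself symmetric; antisymmetry alone
    -- would only give 2 det A = 0 in a general ring. If the second row lies lower, swapping rows 0
    -- and 1 puts both equal rows below the first, where every minor vanishes by induction.
    alternating-zero-suc : ∀ {n} → Alternating n → ∀ (A : Matrix (suc n)) j →
                           A zero ≋ A (suc j) → det A ≈ 0#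
    alternating-zero-suc {suc n} alt A zero    e = trans (expandTwo A)
      (pairs-cancel n _ (belowTwo A)
        (λ j l → trans (*-cong (e j) (sym (e l))) (*-comm _ _)) (belowTwo-cong A))
    alternating-zero-suc {suc n} alt A (suc j) e = begin
      det A                 ≈⟨ +-identityʳ _ ⟨
      det A + 0#            ≈⟨ +-congˡ (alternating-suc-suc alt (swap A) zero (suc j) (λ ()) e) ⟨
      det A + det (swap A)  ≈⟨ det-swap A ⟩
      0#                    ∎

  det-alternating : ∀ n → Alternating n
  det-alternating (suc n) A zero    zero    i≢j e = ⊥-elim (i≢j ≡.refl)
  det-alternating (suc n) A zero    (suc j) i≢j e = alternating-zero-suc (det-alternating n) A j e
  det-alternating (suc n) A (suc i) zero    i≢j e =
    alternating-zero-suc (det-alternating n) A i (sym ∘ e)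
  det-alternating (suc n) A (suc i) (suc j) i≢j e =
    alternating-suc-suc (det-alternating n) A i j (i≢j ∘ ≡.cong suc) e

  -- The combinations of the rows selected by `S`, generated inductively instead of given by
  -- coefficients: each constructor then matches one property of the determinant in
  -- `det-replace-span`. `resp` is there because rows are functions compared entrywise.
  data Span {n} (S : Fin n → Set) (A : Matrix n) : Row n → Set (c ⊔ ℓ) where
    none  : Span S A (λ _ → 0#)
    row   : ∀ {i} → S i → Span S A (A i)
    add   : ∀ {v w} → Span S A v → Span S A w → Span S A (λ j → v j + w j)
    scale : ∀ k {v} → Span S A v → Span S A (λ j → k * v j)
    resp  : ∀ {v w} → v ≋ w → Span S A v → Span S A w

  private
    replace : ∀ {n} → Matrix n → Fin n → Row n → Matrix n
    replace A i v r s with r Fin.≟ i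
    ... | yes _ = v s
    ... | no  _ = A r s

    replace-at : ∀ {n} (A : Matrix n) i v → replace A i v i ≋ v
    replace-at A i v s with i Fin.≟ i
    ... | yes _   = refl
    ... | no  i≢i = ⊥-elim (i≢i ≡.refl)

    replace-off : ∀ {n} (A : Matrix n) i v → AgreeOff i (replace A i v) A
    replace-off A i v r r≢i s with r Fin.≟ i
    ... | yes r≡i = ⊥-elim (r≢i r≡i)
    ... | no  _   = refl

    replace-off₂ : ∀ {n} (A : Matrix n) i v w → AgreeOff i (replace A i v) (replace A i w)
    replace-off₂ A i v w r r≢i s = trans (replace-off A i v r r≢i s) (sym (replace-off A i w r r≢i s))

  -- Linearity in row `i` reduces the claim to a single row `j` in `S`; then `j ≢ i`, and the matrix
  -- has row `j` twice.
  det-replace-span : ∀ {n} {S} {A : Matrix n} {v} i → ¬ S i → Span S A v → det (replace A i v) ≈ 0#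
  det-replace-span {A = A} i i∉S none = trans
    (det-homogeneous i 0# (replace-off₂ A i _ _)
      (λ s → trans (replace-at A i (λ _ → 0#) s) (sym (zeroˡ _))))
    (zeroˡ (det (replace A i λ _ → 0#)))
  det-replace-span {S = S} {A} i i∉S (row {j} j∈S) =
    det-alternating _ (replace A i (A j)) i j i≢j λ s → trans (replace-at A i (A j) s)
      (sym (replace-off A i (A j) j (i≢j ∘ ≡.sym) s))
    where
    i≢j : i ≢ j
    i≢j i≡j = i∉S (≡.subst S (≡.sym i≡j) j∈S)
  det-replace-span {A = A} i i∉S (add {v} {w} p q) = begin
    det (replace A i λ j → v j + w j)
      ≈⟨ det-additive i (replace-off₂ A i _ _) (replace-off₂ A i _ _)
           (λ s → trans (replace-at A i _ s) (sym (+-cong (replace-at A i v s) (replace-at A i w s)))) ⟩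
    det (replace A i v) + det (replace A i w)
      ≈⟨ +-cong (det-replace-span i i∉S p) (det-replace-span i i∉S q) ⟩
    0# + 0#
      ≈⟨ +-identityˡ 0# ⟩
    0# ∎
  det-replace-span {A = A} i i∉S (scale k {v} p) = begin
    det (replace A i λ j → k * v j)
      ≈⟨ det-homogeneous i k (replace-off₂ A i _ _)
           (λ s → trans (replace-at A i _ s) (sym (*-congˡ (replace-at A i v s)))) ⟩
    k * det (replace A i v)
      ≈⟨ *-congˡ (det-replace-span i i∉S p) ⟩
    k * 0#
      ≈⟨ zeroʳ k ⟩
    0# ∎
  det-replace-span {A = A} i i∉S (resp {v} {w} e p) = trans
    (det-cong λ r s → replace-cong r s) (det-replace-span i i∉S p)
    where
    replace-cong : ∀ r → replace A i w r ≋ replace A i v r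
    replace-cong r s with r Fin.≟ i
    ... | yes _ = sym (e s)
    ... | no  _ = refl

  det-addToRow : ∀ {n} {S} {A B : Matrix n} {v} i → ¬ S i → Span S A v → AgreeOff i A B →
                 (∀ s → B i s ≈ A i s + v s) → det B ≈ det A
  det-addToRow {A = A} {B} {v} i i∉S p off e = begin
    det B                      ≈⟨ det-additive i off
                                    (λ r r≢i s → trans (replace-off A i v r r≢i s) (off r r≢i s))
                                    (λ s → trans (e s) (+-congˡ (sym (replace-at A i v s)))) ⟩
    det A + det (replace A i v) ≈⟨ +-congˡ (det-replace-span i i∉S p) ⟩
    det A + 0#                 ≈⟨ +-identityʳ _ ⟩
    det A                      ∎

  -- The rows in `S` are pivots and stay as they are; every other row may gain a combination of
  -- them. If the pivots are listed first, this is multiplication by a block unitriangular matrix.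
  Sheared : ∀ {n} → (Fin n → Set) → Matrix n → Matrix n → Set (c ⊔ ℓ)
  Sheared S A B = ∀ i → (S i × B i ≋ A i) ⊎
    (¬ S i × ∃[ v ] Span S A v × (∀ s → B i s ≈ A i s + v s))

  private
    span-resp : ∀ {n} {S : Fin n → Set} {A B : Matrix n} {v} → (∀ i → S i → A i ≋ B i) →
                Span S A v → Span S B v
    span-resp h none        = none
    span-resp h (row {i} s) = resp (λ j → sym (h i s j)) (row s)
    span-resp h (add p q)   = add (span-resp h p) (span-resp h q)
    span-resp h (scale k p) = scale k (span-resp h p)
    span-resp h (resp e p)  = resp e (span-resp h p)

    mixed : ∀ {n} → Matrix n → Matrix n → ℕ → Matrix n
    mixed A B k i j with toℕ i ℕ.<? k
    ... | yes _ = B i j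
    ... | no  _ = A i j

    mixed-< : ∀ {n} (A B : Matrix n) k {i} → toℕ i ℕ.< k → mixed A B k i ≋ B i
    mixed-< A B k {i} i<k j with toℕ i ℕ.<? k
    ... | yes _   = refl
    ... | no  i≮k = ⊥-elim (i≮k i<k)

    mixed-≮ : ∀ {n} (A B : Matrix n) k {i} → ¬ (toℕ i ℕ.< k) → mixed A B k i ≋ A i
    mixed-≮ A B k {i} i≮k j with toℕ i ℕ.<? k
    ... | yes i<k = ⊥-elim (i≮k i<k)
    ... | no  _   = refl

    mixed-same : ∀ {n} (A B : Matrix n) k {i} → B i ≋ A i → mixed A B k i ≋ A i
    mixed-same A B k {i} e j with toℕ i ℕ.<? k
    ... | yes _ = e j
    ... | no  _ = refl

    mixed-off : ∀ {n} (A B : Matrix n) k i → toℕ i ≡ k →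
                AgreeOff i (mixed A B k) (mixed A B (suc k))
    mixed-off A B k i ≡.refl r r≢i j with ℕ.<-cmp (toℕ r) k
    ... | tri< r<k _ _ = trans (mixed-< A B k r<k j) (sym (mixed-< A B (suc k) (ℕ.m<n⇒m<1+n r<k) j))
    ... | tri≈ _ r≡i _ = ⊥-elim (r≢i (Fin.toℕ-injective r≡i))
    ... | tri> r≮k _ r>k =
      trans (mixed-≮ A B k r≮k j) (sym (mixed-≮ A B (suc k) (λ r<1+k → ℕ.<⇒≱ r>k (ℕ.s≤s⁻¹ r<1+k)) j))

  -- The rows are exchanged one at a time: `mixed A B k` has its first `k` rows from `B`. Pivots
  -- never change, so a combination of pivots of `A` remains one in every intermediate matrix.
  det-sheared : ∀ {n} {S} {A B : Matrix n} → Sheared S A B → det B ≈ det A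
  det-sheared {n} {S} {A} {B} sheared = trans
    (det-cong λ i j → sym (mixed-< A B n (Fin.toℕ<n i) j)) (upTo n ℕ.≤-refl)
    where
    kept : ∀ k i → S i → A i ≋ mixed A B k i
    kept k i i∈S j with sheared i
    ... | inj₁ (_ , e)   = sym (mixed-same A B k e j)
    ... | inj₂ (i∉S , _) = ⊥-elim (i∉S i∈S)

    step : ∀ {k} i → toℕ i ≡ k → det (mixed A B (suc k)) ≈ det (mixed A B k)
    step {k} i i≡k with sheared i
    ... | inj₁ (i∈S , e) = det-cong agree
      where
      agree : ∀ r → mixed A B (suc k) r ≋ mixed A B k r
      agree r j with r Fin.≟ i
      ... | yes ≡.refl = trans (mixed-same A B (suc k) e j) (sym (mixed-same A B k e j))
      ... | no  r≢i    = sym (mixed-off A B k i i≡k r r≢i j)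
    ... | inj₂ (i∉S , v , p , e) =
      det-addToRow i i∉S (span-resp (kept k) p) (mixed-off A B k i i≡k) λ j → begin
        mixed A B (suc k) i j   ≈⟨ mixed-< A B (suc k) (ℕ.s≤s (ℕ.≤-reflexive i≡k)) j ⟩
        B i j                   ≈⟨ e j ⟩
        A i j + v j             ≈⟨ +-congʳ (mixed-≮ A B k (ℕ.<-irrefl i≡k) j) ⟨
        mixed A B k i j + v j   ∎

    upTo : ∀ k → k ℕ.≤ n → det (mixed A B k) ≈ det A
    upTo zero    k≤n = det-cong λ i → mixed-≮ A B 0 λ ()
    upTo (suc k) k≤n = trans (step (Fin.fromℕ< k≤n) (Fin.toℕ-fromℕ< k≤n)) (upTo k (ℕ.<⇒≤ k≤n))

-- Three kinds of edges of a complete graph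

-- The edges of the complete graph on 0, …, m: star i is {0, i + 1}, base is
-- {1, 2}, and rest i j is {i + 1, j + 1}.
data Kind (m : ℕ) : Set where
  star : Fin m → Kind m
  base : Kind m
  rest : Fin m → Fin m → Kind m

-- The clauses with u ≥ v are junk.
kind : ∀ {k} → Fin (4 ℕ.+ k) → Fin (4 ℕ.+ k) → Kind (3 ℕ.+ k)
kind zero          zero                = base
kind zero          (suc i)             = star i
kind (suc i)       zero                = base
kind (suc zero)    (suc zero)          = base
kind (suc zero)    (suc (suc zero))    = base
kind (suc zero)    (suc (suc (suc j))) = rest zero (suc (suc j))
kind (suc (suc i)) (suc j)             = rest (suc i) j

-- A view giving back the endpoints from the kind, so that rows which see only the kind can be
-- compared with formulas in the endpoints.
data OfKind {k} : Fin (4 ℕ.+ k) → Fin (4 ℕ.+ k) → Kind (3 ℕ.+ k) → Set where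
  star : ∀ i → OfKind zero (suc i) (star i)
  base : OfKind (suc zero) (suc (suc zero)) base
  rest : ∀ i j → OfKind (suc i) (suc j) (rest i j)

ofKind : ∀ {k} {u v : Fin (4 ℕ.+ k)} → u Fin.< v → OfKind u v (kind u v)
ofKind {u = zero}        {suc i}             u<v = star i
ofKind {u = suc zero}    {suc (suc zero)}    u<v = base
ofKind {u = suc zero}    {suc (suc (suc j))} u<v = rest _ _
ofKind {u = suc (suc i)} {suc j}             u<v = rest _ _
ofKind {u = suc zero}    {suc zero} (s≤s ())

IsStar IsBase IsRest : ∀ {m} → Kind m → Set
IsStar (star _) = ⊤
IsStar _        = ⊥
IsBase base = ⊤
IsBase _    = ⊥
IsRest (rest _ _) = ⊤
IsRest _          = ⊥

-- The characteristic polynomial of the line graph of a complete graph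

module CompleteLineGraph {c ℓ} (R : CommutativeRing c ℓ) (k : ℕ) {N : ℕ}
  (ends    : Fin N → Fin (4 ℕ.+ k) × Fin (4 ℕ.+ k))
  (ordered : ∀ e → proj₁ (ends e) Fin.< proj₂ (ends e))
  (ends-injective : ∀ {e f} → ends e ≡ ends f → e ≡ f)
  (index   : ∀ {u v} → u Fin.< v → ∃[ e ] ends e ≡ (u , v))
  where

  open CommutativeRing R hiding (zero)
  open Matrices R
  open IntegerCoefficients R
  open Determinants R
  open MonoidSum +-commutativeMonoid using (sum-remove)
  module ∏ = MonoidSum *-commutativeMonoid
  open SetoidReasoning setoid

  V : Set
  V = Fin (4 ℕ.+ k)

  ind : ∀ {n} → Fin n → Fin n → Carrier
  ind u a = if does (u Fin.≟ a) then 1# else 0#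

  ind-≡ : ∀ {n} {u a : Fin n} → u ≡ a → ind u a ≈ 1#
  ind-≡ {u = u} {a} u≡a with u Fin.≟ a
  ... | yes _   = refl
  ... | no  u≢a = ⊥-elim (u≢a u≡a)

  ind-≢ : ∀ {n} {u a : Fin n} → u ≢ a → ind u a ≈ 0#
  ind-≢ {u = u} {a} u≢a with u Fin.≟ a
  ... | yes u≡a = ⊥-elim (u≢a u≡a)
  ... | no  _   = refl

  ∑-ind : ∀ {n} (a : Fin n) → ∑ (λ u → ind u a) ≈ 1#
  ∑-ind {suc n} zero    = trans (∑-suc _)
    (trans (+-congˡ (∑-zero {v = λ u → ind (suc u) (zero {n})} λ u → refl)) (+-identityʳ 1#))
  ∑-ind {suc n} (suc a) = trans (∑-suc _) (trans (+-identityˡ _) (∑-ind a))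

  -- Only the components at a < b matter: they are indexed by the edges {a, b}.
  EdgeVector : Set c
  EdgeVector = V → V → Carrier

  infix 4 _≐_
  _≐_ : EdgeVector → EdgeVector → Set ℓ
  v ≐ w = ∀ {a b} → a Fin.< b → v a b ≈ w a b

  -- Symmetrised, so that a sum over all `v` needs no case split on `u < v`. `δ u u` vanishes at
  -- ordered pairs, so it can be inserted or dropped at will.
  δ : V → V → EdgeVector
  δ u v a b = ind u a * ind v b + ind u b * ind v a

  β : V → EdgeVector
  β u a b = ind u a + ind u b

  σ : Fin (3 ℕ.+ k) → EdgeVector
  σ i = δ zero (suc i)

  γ : Fin (3 ℕ.+ k) → Fin (3 ℕ.+ k) → EdgeVector
  γ i j a b = δ (suc i) (suc j) a b - σ i a b - σ j a b

  κ : EdgeVector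
  κ = γ zero (suc zero)

  -- This is m - 2 with m = 4 + k, the number of `j ≢ i` in `∑-γ-κ`.
  K : Carrier
  K = ∑ {2 ℕ.+ k} λ _ → 1#

  δ-diagonal : ∀ u → δ u u ≐ λ _ _ → 0#
  δ-diagonal u {a} {b} a<b with u Fin.≟ a | u Fin.≟ b
  ... | yes ≡.refl | yes ≡.refl = ⊥-elim (Fin.<-irrefl ≡.refl a<b)
  ... | yes _      | no  _      =
    solve 0 (con (+ 1) :* con (+ 0) :+ con (+ 0) :* con (+ 1) := con (+ 0)) refl
  ... | no  _      | yes _      =
    solve 0 (con (+ 0) :* con (+ 1) :+ con (+ 1) :* con (+ 0) := con (+ 0)) refl
  ... | no  _      | no  _      =
    solve 0 (con (+ 0) :* con (+ 0) :+ con (+ 0) :* con (+ 0) := con (+ 0)) refl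

  δ-sym : ∀ u v a b → δ u v a b ≈ δ v u a b
  δ-sym u v a b = solve 4 (λ p q r s → p :* q :+ r :* s := s :* r :+ q :* p) refl _ _ _ _

  ∑-δ : ∀ u a b → ∑ (λ v → δ u v a b) ≈ β u a b
  ∑-δ u a b = begin
    ∑ (λ v → ind u a * ind v b + ind u b * ind v a)
      ≈⟨ ∑-+ (λ v → ind u a * ind v b) (λ v → ind u b * ind v a) ⟩
    ∑ (λ v → ind u a * ind v b) + ∑ (λ v → ind u b * ind v a)
      ≈⟨ +-cong (∑-* (ind u a) (λ v → ind v b)) (∑-* (ind u b) (λ v → ind v a)) ⟨
    ind u a * ∑ (λ v → ind v b) + ind u b * ∑ (λ v → ind v a)
      ≈⟨ +-cong (*-congˡ (∑-ind b)) (*-congˡ (∑-ind a)) ⟩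
    ind u a * 1# + ind u b * 1#
      ≈⟨ +-cong (*-identityʳ _) (*-identityʳ _) ⟩
    ind u a + ind u b ∎

  ∑-σ : ∀ {a b} → a Fin.< b → ∑ (λ i → σ i a b) ≈ β zero a b
  ∑-σ {a} {b} a<b = begin
    ∑ (λ i → σ i a b)                          ≈⟨ +-identityˡ _ ⟨
    0# + ∑ (λ i → σ i a b)                     ≈⟨ +-congʳ (δ-diagonal zero a<b) ⟨
    δ zero zero a b + ∑ (λ i → σ i a b)        ≈⟨ ∑-suc (λ v → δ zero v a b) ⟨
    ∑ (λ v → δ zero v a b)                     ≈⟨ ∑-δ zero a b ⟩
    β zero a b                                 ∎

  ∑-remove : ∀ {n} i (v : Row (suc n)) → ∑ (v ∘ punchIn i) ≈ ∑ v - v i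
  ∑-remove i v = begin
    ∑ (v ∘ punchIn i)                ≈⟨ solve 2 (λ s x → s := (x :+ s) :- x) refl _ (v i) ⟩
    (v i + ∑ (v ∘ punchIn i)) - v i  ≈⟨ +-congʳ (trans (∑≈sum v) (trans (sum-remove {i = i} v)
                                          (+-congˡ (sym (∑≈sum _))))) ⟨
    ∑ v - v i                        ∎

  ∑-δ-remove : ∀ i {a b} → a Fin.< b →
               ∑ (λ j → δ (suc i) (suc (punchIn i j)) a b) ≈ β (suc i) a b - σ i a b
  ∑-δ-remove i {a} {b} a<b = begin
    ∑ (λ j → δ (suc i) (suc (punchIn i j)) a b)
      ≈⟨ ∑-remove i (λ j → δ (suc i) (suc j) a b) ⟩
    ∑ (λ j → δ (suc i) (suc j) a b) - δ (suc i) (suc i) a b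
      ≈⟨ +-congˡ (-‿cong (δ-diagonal (suc i) a<b)) ⟩
    ∑ (λ j → δ (suc i) (suc j) a b) - 0#
      ≈⟨ solve 2 (λ s x → s :- con (+ 0) := (x :+ s) :- x) refl _ (σ i a b) ⟩
    (σ i a b + ∑ (λ j → δ (suc i) (suc j) a b)) - σ i a b
      ≈⟨ +-congʳ (+-congʳ (δ-sym zero (suc i) a b)) ⟩
    (δ (suc i) zero a b + ∑ (λ j → δ (suc i) (suc j) a b)) - σ i a b
      ≈⟨ +-congʳ (trans (sym (∑-suc (λ v → δ (suc i) v a b))) (∑-δ (suc i) a b)) ⟩
    β (suc i) a b - σ i a b ∎

  ∑-const : ∀ n x → ∑ {n} (λ _ → x) ≈ ∑ {n} (λ _ → 1#) * x
  ∑-const n x = begin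
    ∑ {n} (λ _ → x)        ≈⟨ ∑-cong (λ _ → sym (*-identityʳ x)) ⟩
    ∑ {n} (λ _ → x * 1#)   ≈⟨ ∑-* x _ ⟨
    x * ∑ {n} (λ _ → 1#)   ≈⟨ *-comm x _ ⟩
    ∑ {n} (λ _ → 1#) * x   ∎

  ∑-1≈int : ∀ n → ∑ {n} (λ _ → 1#) ≈ int (+ n)
  ∑-1≈int zero    = ∑-empty _
  ∑-1≈int (suc n) = trans (∑-suc _) (trans (+-congˡ (∑-1≈int n)) (sym (int-+ (+ 1) (+ n))))

  -- Over `j ≢ i`, the `δ (suc i) (suc j)` add up to β_i - σ_i and the `σ j` to β_0 - σ_i, so the
  -- two σ_i cancel. The remaining -(σ_i + κ) occurs once for each of the `K` summands.
  ∑-γ-κ : ∀ i {a b} → a Fin.< b → ∑ (λ j → γ i (punchIn i j) a b - κ a b) ≈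
          β (suc i) a b - β zero a b - K * (σ i a b + κ a b)
  ∑-γ-κ i {a} {b} a<b = begin
    ∑ (λ j → γ i (punchIn i j) a b - κ a b)
      ≈⟨ ∑-cong (λ j → solve 4 (λ d x s z → d :- x :- s :- z :=
             d :+ (:- con (+ 1) :* s :+ :- con (+ 1) :* (x :+ z))) refl
           (δ (suc i) (suc (punchIn i j)) a b) s₀ (σ (punchIn i j) a b) (κ a b)) ⟩
    ∑ (λ j → D j + (- 1# * S j + W j))
      ≈⟨ trans (∑-+ D _) (+-congˡ (∑-+ (λ j → - 1# * S j) W)) ⟩
    ∑ D + (∑ (λ j → - 1# * S j) + ∑ W)
      ≈⟨ +-cong (∑-δ-remove i a<b) (+-cong
           (trans (sym (∑-* (- 1#) S)) (*-congˡ (trans (∑-remove i (λ j → σ j a b)) (+-congʳ (∑-σ a<b)))))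
           (∑-const _ _)) ⟩
    (β (suc i) a b - s₀) + (- 1# * (β zero a b - s₀) + K * (- 1# * (s₀ + κ a b)))
      ≈⟨ solve 5 (λ b s z k c → (b :- s) :+ (:- con (+ 1) :* (z :- s) :+ k :* (:- con (+ 1) :* (s :+ c)))
                              := b :- z :- k :* (s :+ c)) refl
           (β (suc i) a b) s₀ (β zero a b) K (κ a b) ⟩
    β (suc i) a b - β zero a b - K * (s₀ + κ a b) ∎
    where
    s₀ = σ i a b
    D S W : Row (2 ℕ.+ k)
    D j = δ (suc i) (suc (punchIn i j)) a b
    S j = σ (punchIn i j) a b
    W j = - 1# * (s₀ + κ a b)

  -- A row depends on its edge only through the kind. Every row operation is thus described in three
  -- cases, independently of the order in which the edges are listed.
  Family : Set c
  Family = Kind (3 ℕ.+ k) → EdgeVector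

  kindOf : Fin N → Kind (3 ℕ.+ k)
  kindOf e = kind (proj₁ (ends e)) (proj₂ (ends e))

  at : EdgeVector → Row N
  at v f = v (proj₁ (ends f)) (proj₂ (ends f))

  matrix : Family → Matrix N
  matrix ρ e = at (ρ (kindOf e))

  SpanOf : (Kind (3 ℕ.+ k) → Set) → Family → EdgeVector → Set (c ⊔ ℓ)
  SpanOf T ρ v = Span (T ∘ kindOf) (matrix ρ) (at v)

  resp-≐ : ∀ {T ρ v w} → v ≐ w → SpanOf T ρ v → SpanOf T ρ w
  resp-≐ h = resp (λ f → h (ordered f))

  row-≐ : ∀ {T ρ u v} → u Fin.< v → T (kind u v) → SpanOf T ρ (ρ (kind u v))
  row-≐ {T} {ρ} u<v t with index u<v
  ... | e , ≡.refl = row t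

  ∑-span : ∀ T ρ {n} (v : Fin n → EdgeVector) → (∀ i → SpanOf T ρ (v i)) →
           SpanOf T ρ (λ a b → ∑ λ i → v i a b)
  ∑-span T ρ {zero}  v h = resp (λ f → sym (∑-empty _)) none
  ∑-span T ρ {suc n} v h = resp (λ f → sym (∑-suc _)) (add (h zero) (∑-span T ρ (v ∘ suc) (h ∘ suc)))

  ShearedAt : (Kind (3 ℕ.+ k) → Set) → Family → Family → Kind (3 ℕ.+ k) → Set (c ⊔ ℓ)
  ShearedAt T ρ ρ′ t = (T t × ρ′ t ≐ ρ t) ⊎
    (¬ T t × ∃[ v ] SpanOf T ρ v × ρ′ t ≐ (λ a b → ρ t a b + v a b))

  det-matrix-sheared : ∀ {T ρ ρ′} →
    (∀ i → ShearedAt T ρ ρ′ (star i)) → ShearedAt T ρ ρ′ base →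
    (∀ i j → ShearedAt T ρ ρ′ (rest i j)) → det (matrix ρ) ≈ det (matrix ρ′)
  det-matrix-sheared {T} {ρ} {ρ′} hs hb hr = sym (det-sheared λ e → convert e (sheared (ofKind (ordered e))))
    where
    sheared : ∀ {u v t} → OfKind u v t → ShearedAt T ρ ρ′ t
    sheared (star i)   = hs i
    sheared base       = hb
    sheared (rest i j) = hr i j

    convert : ∀ e → ShearedAt T ρ ρ′ (kindOf e) →
      (T (kindOf e) × matrix ρ′ e ≋ matrix ρ e) ⊎
      (¬ T (kindOf e) × ∃[ v ] Span (T ∘ kindOf) (matrix ρ) v × (∀ s → matrix ρ′ e s ≈ matrix ρ e s + v s))
    convert e (inj₁ (t , h))          = inj₁ (t , λ f → h (ordered f))
    convert e (inj₂ (¬t , v , p , h)) = inj₂ (¬t , at v , p , λ f → h (ordered f))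

  det-matrix-scaled : ∀ (d : Kind (3 ℕ.+ k) → Carrier) ρ ρ′ → (∀ t → ρ t ≐ λ a b → d t * ρ′ t a b) →
    det (matrix ρ) ≈ product (d ∘ kindOf) * det (matrix ρ′)
  det-matrix-scaled d ρ ρ′ h = det-scaleRows (d ∘ kindOf) λ e f → h (kindOf e) (ordered f)

  family : (Fin (3 ℕ.+ k) → EdgeVector) → EdgeVector →
           (Fin (3 ℕ.+ k) → Fin (3 ℕ.+ k) → EdgeVector) → Family
  family S B T (star i)   = S i
  family S B T base       = B
  family S B T (rest i j) = T i j

  spectral : Carrier → Carrier → Carrier → Kind (3 ℕ.+ k) → Carrier
  spectral s b t (star _)   = s
  spectral s b t base       = b
  spectral s b t (rest _ _) = t

  -- The row reduction

  module _ (y : Carrier) where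

    r : V → V → EdgeVector
    r u v a b = y * δ u v a b - β u a b - β v a b

    -- This is r_{ij} - r_{0i} - r_{0j}: the terms β_i and β_j cancel, and the leftover 2 β_0 is the
    -- same for all `i` and `j`. Hence subtracting the base row removes it from the rest rows in
    -- `shear₂`.
    g : Fin (3 ℕ.+ k) → Fin (3 ℕ.+ k) → EdgeVector
    g i j a b = y * γ i j a b + (β zero a b + β zero a b)

    -- A prime marks the rows after the scalar of one kind has been pulled out.
    ρ₀ ρ₁ ρ₂ ρ₂′ ρ₃ ρ₃′ ρ₄ ρ₄′ ρ₅ ρ₆ : Family
    ρ₀  = family (λ i → r zero (suc i)) (r (suc zero) (suc (suc zero))) (λ i j → r (suc i) (suc j))
    ρ₁  = family (λ i → r zero (suc i)) (g zero (suc zero)) g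
    ρ₂  = family (λ i a b → y * (σ i a b + κ a b) + (β zero a b - β (suc i) a b)) (g zero (suc zero))
            (λ i j a b → y * (γ i j a b - κ a b))
    ρ₂′ = family (λ i a b → y * (σ i a b + κ a b) + (β zero a b - β (suc i) a b)) (g zero (suc zero))
            (λ i j a b → γ i j a b - κ a b)
    ρ₃  = family (λ i a b → (y - K) * (σ i a b + κ a b)) (g zero (suc zero))
            (λ i j a b → γ i j a b - κ a b)
    ρ₃′ = family (λ i a b → σ i a b + κ a b) (g zero (suc zero)) (λ i j a b → γ i j a b - κ a b)
    ρ₄  = family (λ i a b → σ i a b + κ a b) (λ a b → (y - (1# + K + (1# + K))) * κ a b)
            (λ i j a b → γ i j a b - κ a b)
    ρ₄′ = family (λ i a b → σ i a b + κ a b) κ (λ i j a b → γ i j a b - κ a b)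
    ρ₅  = family σ κ γ
    ρ₆  = family σ (δ (suc zero) (suc (suc zero))) (λ i j → δ (suc i) (suc j))

    star-row : ∀ (ρ : Family) i → SpanOf IsStar ρ (ρ (star i))
    star-row ρ i = row-≐ {IsStar} {ρ} {zero} {suc i} (s≤s z≤n) tt

    base-row : ∀ (ρ : Family) → SpanOf IsBase ρ (ρ base)
    base-row ρ = row-≐ {IsBase} {ρ} {suc zero} {suc (suc zero)} (s≤s (s≤s z≤n)) tt

    pair : Family → Carrier → Fin (3 ℕ.+ k) → Fin (3 ℕ.+ k) → EdgeVector
    pair ρ s i j a b = s * ρ (star i) a b + s * ρ (star j) a b

    pair-span : ∀ ρ s i j → SpanOf IsStar ρ (pair ρ s i j)
    pair-span ρ s i j = add (scale s (star-row ρ i)) (scale s (star-row ρ j))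

    shear₁ : det (matrix ρ₀) ≈ det (matrix ρ₁)
    shear₁ = det-matrix-sheared {IsStar} {ρ₀} {ρ₁} (λ i → inj₁ (tt , λ _ → refl))
      (inj₂ ((λ ()) , pair ρ₀ (- 1#) zero (suc zero) , pair-span ρ₀ (- 1#) zero (suc zero) ,
        λ {a} {b} _ → clear zero (suc zero) a b))
      (λ i j → inj₂ ((λ ()) , pair ρ₀ (- 1#) i j , pair-span ρ₀ (- 1#) i j , λ {a} {b} _ → clear i j a b))
      where
      clear : ∀ i j a b → g i j a b ≈ r (suc i) (suc j) a b + pair ρ₀ (- 1#) i j a b
      clear i j a b = solve 7 (λ y d s t p q z →
        y :* (d :- s :- t) :+ (z :+ z) := (y :* d :- p :- q) :+
          (:- con (+ 1) :* (y :* s :- z :- p) :+ :- con (+ 1) :* (y :* t :- z :- q))) refl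
        y (δ (suc i) (suc j) a b) (σ i a b) (σ j a b) (β (suc i) a b) (β (suc j) a b) (β zero a b)

    shear₂ : det (matrix ρ₁) ≈ det (matrix ρ₂)
    shear₂ = det-matrix-sheared {IsBase} {ρ₁} {ρ₂}
      (λ i → inj₂ ((λ ()) , _ , base-row ρ₁ , λ {a} {b} _ →
        solve 5 (λ y s c z p → y :* (s :+ c) :+ (z :- p) :=
                               (y :* s :- z :- p) :+ (y :* c :+ (z :+ z))) refl
          y (σ i a b) (κ a b) (β zero a b) (β (suc i) a b)))
      (inj₁ (tt , λ _ → refl))
      (λ i j → inj₂ ((λ ()) , _ , scale (- 1#) (base-row ρ₁) , λ {a} {b} _ →
        solve 4 (λ y g c z → y :* (g :- c) :=
          (y :* g :+ (z :+ z)) :+ :- con (+ 1) :* (y :* c :+ (z :+ z))) refl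
          y (γ i j a b) (κ a b) (β zero a b)))

    scale₂ : det (matrix ρ₂) ≈ product (spectral 1# 1# y ∘ kindOf) * det (matrix ρ₂′)
    scale₂ = det-matrix-scaled (spectral 1# 1# y) ρ₂ ρ₂′ λ where
      (star i)   _ → sym (*-identityˡ _)
      base       _ → sym (*-identityˡ _)
      (rest i j) _ → refl

    γ-sym : ∀ i j a b → γ i j a b ≈ γ j i a b
    γ-sym i j a b = trans (solve 3 (λ d s t → d :- s :- t := d :- t :- s) refl _ (σ i a b) (σ j a b))
      (+-congʳ (+-congʳ (δ-sym (suc i) (suc j) a b)))

    rest-row : ∀ i j → i Fin.< j → SpanOf IsRest ρ₂′ (λ a b → γ i j a b - κ a b)
    -- The pair (0 , 1) belongs to the base edge, so no rest row stands for it; but there the vector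
    -- is κ - κ.
    rest-row zero    (suc zero)    i<j = resp-≐ {IsRest} {ρ₂′} {λ _ _ → 0#} {λ a b → κ a b - κ a b}
      (λ {a} {b} _ → sym (-‿inverseʳ (κ a b))) none
    rest-row zero    (suc (suc j)) i<j = row-≐ {IsRest} {ρ₂′} (s≤s i<j) tt
    rest-row (suc i) (suc j)       i<j = row-≐ {IsRest} {ρ₂′} (s≤s i<j) tt

    rest-span : ∀ i j → i ≢ j → SpanOf IsRest ρ₂′ (λ a b → γ i j a b - κ a b)
    rest-span i j i≢j with Fin.<-cmp i j
    ... | tri< i<j _ _ = rest-row i j i<j
    ... | tri≈ _ i≡j _ = ⊥-elim (i≢j i≡j)
    ... | tri> _ _ j<i = resp-≐ {IsRest} {ρ₂′} {λ a b → γ j i a b - κ a b} {λ a b → γ i j a b - κ a b}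
      (λ {a} {b} _ → +-congʳ (γ-sym j i a b)) (rest-row j i j<i)

    -- Adding all γ_{ij} - κ with j ≠ i to star row `i` turns its remainder β_0 - β_i into -K (σ_i +
    -- κ), by `∑-γ-κ`.
    shear₃ : det (matrix ρ₂′) ≈ det (matrix ρ₃)
    shear₃ = det-matrix-sheared {IsRest} {ρ₂′} {ρ₃}
      (λ i → inj₂ ((λ ()) , _ ,
        ∑-span IsRest ρ₂′ (λ j a b → γ i (punchIn i j) a b - κ a b)
          (λ j → rest-span i (punchIn i j) (Fin.punchInᵢ≢i i j ∘ ≡.sym)) ,
        λ {a} {b} a<b → trans
          (solve 6 (λ y k s c z p → (y :- k) :* (s :+ c) :=
             (y :* (s :+ c) :+ (z :- p)) :+ (p :- z :- k :* (s :+ c))) refl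
             y K (σ i a b) (κ a b) (β zero a b) (β (suc i) a b))
          (+-congˡ (sym (∑-γ-κ i a<b)))))
      (inj₂ ((λ ()) , _ , none , λ _ → sym (+-identityʳ _)))
      (λ i j → inj₁ (tt , λ _ → refl))

    scale₃ : det (matrix ρ₃) ≈ product (spectral (y - K) 1# 1# ∘ kindOf) * det (matrix ρ₃′)
    scale₃ = det-matrix-scaled (spectral (y - K) 1# 1#) ρ₃ ρ₃′ λ where
      (star i)   _ → refl
      base       _ → sym (*-identityˡ _)
      (rest i j) _ → sym (*-identityˡ _)

    -- The 1 + K star rows add up to β_0 + (1 + K) κ. Subtracting this sum twice removes the 2 β_0
    -- of the base row and lowers its coefficient of κ by 2 (1 + K).
    shear₄ : det (matrix ρ₃′) ≈ det (matrix ρ₄)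
    shear₄ = det-matrix-sheared {IsStar} {ρ₃′} {ρ₄}
      (λ i → inj₁ (tt , λ _ → refl))
      (inj₂ ((λ ()) , _ ,
        scale (- (1# + 1#)) (∑-span IsStar ρ₃′ (λ i a b → σ i a b + κ a b) (star-row ρ₃′)) ,
        λ {a} {b} a<b → trans
          (solve 4 (λ y k c z → (y :- (con (+ 1) :+ k :+ (con (+ 1) :+ k))) :* c :=
             (y :* c :+ (z :+ z)) :+ :- (con (+ 1) :+ con (+ 1)) :* (z :+ (con (+ 1) :+ k) :* c)) refl
             y K (κ a b) (β zero a b))
          (+-congˡ (*-congˡ (sym (trans (∑-+ (λ i → σ i a b) (λ i → κ a b))
            (+-cong (∑-σ a<b) (trans (∑-const _ _) (*-congʳ (∑-suc _))))))))))
      (λ i j → inj₂ ((λ ()) , _ , none , λ _ → sym (+-identityʳ _)))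

    scale₄ : det (matrix ρ₄) ≈
             product (spectral 1# (y - (1# + K + (1# + K))) 1# ∘ kindOf) * det (matrix ρ₄′)
    scale₄ = det-matrix-scaled (spectral 1# (y - (1# + K + (1# + K))) 1#) ρ₄ ρ₄′ λ where
      (star i)   _ → sym (*-identityˡ _)
      base       _ → refl
      (rest i j) _ → sym (*-identityˡ _)

    shear₅ : det (matrix ρ₄′) ≈ det (matrix ρ₅)
    shear₅ = det-matrix-sheared {IsBase} {ρ₄′} {ρ₅}
      (λ i → inj₂ ((λ ()) , _ , scale (- 1#) (base-row ρ₄′) , λ {a} {b} _ →
        solve 2 (λ s c → s := (s :+ c) :+ :- con (+ 1) :* c) refl (σ i a b) (κ a b)))
      (inj₁ (tt , λ _ → refl))
      (λ i j → inj₂ ((λ ()) , _ , base-row ρ₄′ , λ {a} {b} _ →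
        solve 2 (λ s c → s := (s :- c) :+ c) refl (γ i j a b) (κ a b)))

    -- The inverse of the combination in `shear₁`: adding the two star rows back turns γ_{ij} into
    -- the unit vector of its edge.
    shear₆ : det (matrix ρ₅) ≈ det (matrix ρ₆)
    shear₆ = det-matrix-sheared {IsStar} {ρ₅} {ρ₆} (λ i → inj₁ (tt , λ _ → refl))
      (inj₂ ((λ ()) , pair ρ₅ 1# zero (suc zero) , pair-span ρ₅ 1# zero (suc zero) ,
        λ {a} {b} _ → restore zero (suc zero) a b))
      (λ i j → inj₂ ((λ ()) , pair ρ₅ 1# i j , pair-span ρ₅ 1# i j , λ {a} {b} _ → restore i j a b))
      where
      restore : ∀ i j a b → δ (suc i) (suc j) a b ≈ γ i j a b + pair ρ₅ 1# i j a b
      restore i j a b = solve 3 (λ d s t → d := (d :- s :- t) :+ (con (+ 1) :* s :+ con (+ 1) :* t)) refl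
        (δ (suc i) (suc j) a b) (σ i a b) (σ j a b)

    det-ρ₀ : det (matrix ρ₀) ≈
             product (spectral (y - K) (y - (1# + K + (1# + K))) y ∘ kindOf) * det (matrix ρ₆)
    det-ρ₀ = begin
      det (matrix ρ₀)                        ≈⟨ trans shear₁ (trans shear₂ scale₂) ⟩
      p * det (matrix ρ₂′)                   ≈⟨ *-congˡ (trans shear₃ scale₃) ⟩
      p * (q * det (matrix ρ₃′))             ≈⟨ *-congˡ (*-congˡ (trans shear₄ scale₄)) ⟩
      p * (q * (s * det (matrix ρ₄′)))       ≈⟨ *-congˡ (*-congˡ (*-congˡ (trans shear₅ shear₆))) ⟩
      p * (q * (s * det (matrix ρ₆)))
        ≈⟨ solve 4 (λ p q s d → p :* (q :* (s :* d)) := (p :* (q :* s)) :* d) refl _ _ _ _ ⟩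
      (p * (q * s)) * det (matrix ρ₆)
        ≈⟨ *-congʳ (*-congˡ (∏.∑-distrib-+ (v ∘ kindOf) (w ∘ kindOf))) ⟨
      (p * product (λ e → v (kindOf e) * w (kindOf e))) * det (matrix ρ₆)
        ≈⟨ *-congʳ (∏.∑-distrib-+ (u ∘ kindOf) (λ e → v (kindOf e) * w (kindOf e))) ⟨
      product (λ e → u (kindOf e) * (v (kindOf e) * w (kindOf e))) * det (matrix ρ₆)
        ≈⟨ *-congʳ (∏.sum-cong-≋ λ e → combine (kindOf e)) ⟩
      product (spectral (y - K) (y - (1# + K + (1# + K))) y ∘ kindOf) * det (matrix ρ₆) ∎
      where
      u v w : Kind (3 ℕ.+ k) → Carrier
      u = spectral 1# 1# y
      v = spectral (y - K) 1# 1#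
      w = spectral 1# (y - (1# + K + (1# + K))) 1#
      p = product (u ∘ kindOf)
      q = product (v ∘ kindOf)
      s = product (w ∘ kindOf)
      combine : ∀ t → u t * (v t * w t) ≈ spectral (y - K) (y - (1# + K + (1# + K))) y t
      combine (star _)   = trans (*-identityˡ _) (*-identityʳ _)
      combine base       = trans (*-identityˡ _) (*-identityˡ _)
      combine (rest _ _) = trans (*-congˡ (*-identityˡ 1#)) (*-identityʳ y)

  -- Both ends of the reduction: the identity matrix and the characteristic matrix

  δ-edge-≡ : ∀ {u v} → u Fin.< v → δ u v u v ≈ 1#
  δ-edge-≡ {u} {v} u<v = begin
    ind u u * ind v v + ind u v * ind v u
      ≈⟨ +-cong (*-cong (ind-≡ {u = u} ≡.refl) (ind-≡ {u = v} ≡.refl)) (*-congʳ (ind-≢ (Fin.<⇒≢ u<v))) ⟩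
    1# * 1# + 0# * ind v u
      ≈⟨ solve 1 (λ x → con (+ 1) :* con (+ 1) :+ con (+ 0) :* x := con (+ 1)) refl (ind v u) ⟩
    1# ∎

  δ-edge-≢ : ∀ {u v a b} → u Fin.< v → a Fin.< b → ¬ (u ≡ a × v ≡ b) → δ u v a b ≈ 0#
  δ-edge-≢ {u} {v} {a} {b} u<v a<b ≢ with u Fin.≟ a | v Fin.≟ b | u Fin.≟ b | v Fin.≟ a
  ... | yes u≡a    | yes v≡b    | _          | _          = ⊥-elim (≢ (u≡a , v≡b))
  -- A crosswise match u = b, v = a would contradict u < v and a < b, so only the first product in
  -- `δ` can be nonzero.
  ... | _          | _          | yes ≡.refl | yes ≡.refl = ⊥-elim (Fin.<-asym u<v a<b)
  ... | no  _      | _          | no  _      | _          =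
    trans (+-cong (zeroˡ _) (zeroˡ _)) (+-identityˡ 0#)
  ... | no  _      | _          | yes _      | no  _      =
    trans (+-cong (zeroˡ _) (zeroʳ _)) (+-identityˡ 0#)
  ... | yes _      | no  _      | no  _      | _          =
    trans (+-cong (zeroʳ _) (zeroˡ _)) (+-identityˡ 0#)
  ... | yes _      | no  _      | yes _      | no  _      =
    trans (+-cong (zeroʳ _) (zeroʳ _)) (+-identityˡ 0#)

  det-ρ₆ : ∀ y → det (matrix (ρ₆ y)) ≈ 1#
  det-ρ₆ y = trans (det-cong λ e f → entry e f) (det-identity N)
    where
    ρ₆-edge : ∀ {u v t} → OfKind u v t → ∀ {a b} → ρ₆ y t a b ≈ δ u v a b
    ρ₆-edge (star i)   = refl
    ρ₆-edge base       = refl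
    ρ₆-edge (rest i j) = refl

    entry : ∀ e f → matrix (ρ₆ y) e f ≈ scalar N 1# e f
    entry e f with e Fin.≟ f
    ... | yes ≡.refl = trans (ρ₆-edge (ofKind (ordered e))) (δ-edge-≡ (ordered e))
    ... | no  e≢f    = trans (ρ₆-edge (ofKind (ordered e)))
      (δ-edge-≢ (ordered e) (ordered f) λ (p , q) → e≢f (ends-injective (≡.cong₂ _,_ p q)))

  Share : V → V → V → V → Set
  Share u v a b = ∃[ w ] (w ≡ u ⊎ w ≡ v) × (w ≡ a ⊎ w ≡ b)


  β-eval : ∀ {u v a b p q s t} → ind u a ≈ p → ind u b ≈ q → ind v a ≈ s → ind v b ≈ t →
           β u a b + β v a b ≈ (p + q) + (s + t)
  β-eval p q s t = +-cong (+-cong p q) (+-cong s t)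

  β-self : ∀ {u v} → u Fin.< v → β u u v + β v u v ≈ 1# + 1#
  β-self {u} {v} u<v = trans
    (β-eval {u} {v} {u} {v} (ind-≡ {u = u} ≡.refl) (ind-≢ (Fin.<⇒≢ u<v))
      (ind-≢ (Fin.<⇒≢ u<v ∘ ≡.sym)) (ind-≡ {u = v} ≡.refl))
    (solve 0 ((con (+ 1) :+ con (+ 0)) :+ (con (+ 0) :+ con (+ 1)) := con (+ 1) :+ con (+ 1)) refl)

  β-shared : ∀ {u v a b} → u Fin.< v → a Fin.< b → ¬ (u ≡ a × v ≡ b) → Share u v a b →
             β u a b + β v a b ≈ 1#
  β-shared {u} {v} {a} {b} u<v a<b ≢ (w , inj₁ ≡.refl , inj₁ ≡.refl) = trans
    (β-eval {u} {v} {a} {b} (ind-≡ {u = u} ≡.refl) (ind-≢ (Fin.<⇒≢ a<b))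
      (ind-≢ (Fin.<⇒≢ u<v ∘ ≡.sym)) (ind-≢ λ e → ≢ (≡.refl , e)))
    (solve 0 ((con (+ 1) :+ con (+ 0)) :+ (con (+ 0) :+ con (+ 0)) := con (+ 1)) refl)
  β-shared {u} {v} {a} {b} u<v a<b ≢ (w , inj₁ ≡.refl , inj₂ ≡.refl) = trans
    (β-eval {u} {v} {a} {b} (ind-≢ (Fin.<⇒≢ a<b ∘ ≡.sym)) (ind-≡ {u = u} ≡.refl)
      (ind-≢ {u = v} {a} λ { ≡.refl → Fin.<-asym u<v a<b }) (ind-≢ (Fin.<⇒≢ u<v ∘ ≡.sym)))
    (solve 0 ((con (+ 0) :+ con (+ 1)) :+ (con (+ 0) :+ con (+ 0)) := con (+ 1)) refl)
  β-shared {u} {v} {a} {b} u<v a<b ≢ (w , inj₂ ≡.refl , inj₁ ≡.refl) = trans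
    (β-eval {u} {v} {a} {b} (ind-≢ (Fin.<⇒≢ u<v))
      (ind-≢ {u = u} {b} λ { ≡.refl → Fin.<-asym u<v a<b }) (ind-≡ {u = v} ≡.refl)
      (ind-≢ (Fin.<⇒≢ a<b)))
    (solve 0 ((con (+ 0) :+ con (+ 0)) :+ (con (+ 1) :+ con (+ 0)) := con (+ 1)) refl)
  β-shared {u} {v} {a} {b} u<v a<b ≢ (w , inj₂ ≡.refl , inj₂ ≡.refl) = trans
    (β-eval {u} {v} {a} {b} (ind-≢ λ e → ≢ (e , ≡.refl)) (ind-≢ (Fin.<⇒≢ u<v))
      (ind-≢ (Fin.<⇒≢ a<b ∘ ≡.sym)) (ind-≡ {u = v} ≡.refl))
    (solve 0 ((con (+ 0) :+ con (+ 0)) :+ (con (+ 0) :+ con (+ 1)) := con (+ 1)) refl)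

  β-disjoint : ∀ {u v a b} → ¬ Share u v a b → β u a b + β v a b ≈ 0#
  β-disjoint {u} {v} {a} {b} ¬s = trans
    (β-eval {u} {v} {a} {b}
      (ind-≢ λ e → ¬s (u , inj₁ ≡.refl , inj₁ e)) (ind-≢ λ e → ¬s (u , inj₁ ≡.refl , inj₂ e))
      (ind-≢ λ e → ¬s (v , inj₂ ≡.refl , inj₁ e)) (ind-≢ λ e → ¬s (v , inj₂ ≡.refl , inj₂ e)))
    (solve 0 ((con (+ 0) :+ con (+ 0)) :+ (con (+ 0) :+ con (+ 0)) := con (+ 0)) refl)

  module _ {Adjacent : Fin N → Fin N → Set} (adjacent? : ∀ e f → Dec (Adjacent e f))
    (to   : ∀ {e f} → Adjacent e f → ends e ≢ ends f ×
            Share (proj₁ (ends e)) (proj₂ (ends e)) (proj₁ (ends f)) (proj₂ (ends f)))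
    (from : ∀ {e f} → ends e ≢ ends f →
            Share (proj₁ (ends e)) (proj₂ (ends e)) (proj₁ (ends f)) (proj₂ (ends f)) → Adjacent e f)
    where

    adjacencyMatrix : Matrix N
    adjacencyMatrix e f = if does (adjacent? e f) then 1# else 0#

    -- The value of β_u + β_v at the edge {a, b} counts common endpoints: 2 on the diagonal, 1 for
    -- adjacent edges and 0 for disjoint ones. The 2 on the diagonal is the shift from `x` to
    -- `x + 1# + 1#`.
    charPoly-entry : ∀ x e f → scalar N x e f - adjacencyMatrix e f ≈ matrix (ρ₀ (x + 1# + 1#)) e f
    charPoly-entry x e f = trans (by-cases (e Fin.≟ f) (adjacent? e f)) (sym (ρ₀-edge (ofKind (ordered e))))
      where
      u = proj₁ (ends e)
      v = proj₂ (ends e)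
      a = proj₁ (ends f)
      b = proj₂ (ends f)

      ρ₀-edge : ∀ {u v t} → OfKind u v t → ∀ {a b} → ρ₀ (x + 1# + 1#) t a b ≈ r (x + 1# + 1#) u v a b
      ρ₀-edge (star i)   = refl
      ρ₀-edge base       = refl
      ρ₀-edge (rest i j) = refl

      row-eval : ∀ {p q} → δ u v a b ≈ p → β u a b + β v a b ≈ q →
                 r (x + 1# + 1#) u v a b ≈ (x + 1# + 1#) * p - q
      row-eval {p} {q} hp hq = begin
        (x + 1# + 1#) * δ u v a b - β u a b - β v a b
          ≈⟨ solve 4 (λ y d s t → y :* d :- s :- t := y :* d :- (s :+ t)) refl _ _ _ _ ⟩
        (x + 1# + 1#) * δ u v a b - (β u a b + β v a b)
          ≈⟨ +-cong (*-congˡ hp) (-‿cong hq) ⟩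
        (x + 1# + 1#) * p - q ∎

      ends-≢ : e ≢ f → ¬ (u ≡ a × v ≡ b)
      ends-≢ e≢f (p , q) = e≢f (ends-injective (≡.cong₂ _,_ p q))

      by-cases : (d : Dec (e ≡ f)) (d′ : Dec (Adjacent e f)) →
        (if does d then x else 0#) - (if does d′ then 1# else 0#) ≈ r (x + 1# + 1#) u v a b
      by-cases (yes ≡.refl) (yes adj) = ⊥-elim (proj₁ (to adj) ≡.refl)
      by-cases (yes ≡.refl) (no  _)   = trans
        (solve 1 (λ x → x :- con (+ 0) := (x :+ con (+ 1) :+ con (+ 1)) :* con (+ 1) :-
                                        (con (+ 1) :+ con (+ 1))) refl x)
        (sym (row-eval (δ-edge-≡ (ordered e)) (β-self (ordered e))))
      by-cases (no e≢f) (yes adj) = trans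
        (solve 1 (λ x → con (+ 0) :- con (+ 1) :=
                         (x :+ con (+ 1) :+ con (+ 1)) :* con (+ 0) :- con (+ 1)) refl x)
        (sym (row-eval (δ-edge-≢ (ordered e) (ordered f) (ends-≢ e≢f))
          (β-shared (ordered e) (ordered f) (ends-≢ e≢f) (proj₂ (to adj)))))
      by-cases (no e≢f) (no ¬adj) = trans
        (solve 1 (λ x → con (+ 0) :- con (+ 0) :=
                         (x :+ con (+ 1) :+ con (+ 1)) :* con (+ 0) :- con (+ 0)) refl x)
        (sym (row-eval (δ-edge-≢ (ordered e) (ordered f) (ends-≢ e≢f))
          (β-disjoint {u} {v} {a} {b} λ s → ¬adj (from (e≢f ∘ ends-injective) s))))

    eigenvalue : Kind (3 ℕ.+ k) → Carrier
    eigenvalue = spectral (int (+ k)) (int (+ (4 ℕ.+ (k ℕ.+ k)))) (int (ℤ.- + 2))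

    K≈int : K ≈ int (+ (2 ℕ.+ k))
    K≈int = ∑-1≈int (2 ℕ.+ k)

    eigenvalues : AreEigenvalues adjacencyMatrix (eigenvalue ∘ kindOf)
    eigenvalues x = begin
      charPoly adjacencyMatrix x
        ≈⟨ det-cong (charPoly-entry x) ⟩
      det (matrix (ρ₀ y))
        ≈⟨ trans (det-ρ₀ y) (trans (*-congˡ (det-ρ₆ y)) (*-identityʳ _)) ⟩
      product (spectral (y - K) (y - (1# + K + (1# + K))) y ∘ kindOf)
        ≈⟨ (∏.sum-cong-≋ λ e → shift (kindOf e)) ⟩
      product (λ e → x - eigenvalue (kindOf e)) ∎
      where
      y = x + 1# + 1#
      i = int (+ k)

      K≈ : K ≈ 1# + 1# + i
      K≈ = trans K≈int (trans (int-+ (+ 2) (+ k)) refl)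

      shift : ∀ t → spectral (y - K) (y - (1# + K + (1# + K))) y t ≈ x - eigenvalue t
      shift (star _) = trans (+-congˡ (-‿cong K≈))
        (solve 2 (λ x i → (x :+ con (+ 1) :+ con (+ 1)) :- (con (+ 1) :+ con (+ 1) :+ i) := x :- i) refl x i)
      shift base = trans (+-congˡ (-‿cong (+-cong (+-congˡ K≈) (+-congˡ K≈))))
        (trans (solve 2 (λ x i → (x :+ con (+ 1) :+ con (+ 1)) :-
             (con (+ 1) :+ (con (+ 1) :+ con (+ 1) :+ i) :+ (con (+ 1) :+ (con (+ 1) :+ con (+ 1) :+ i))) :=
             x :- (con (+ 4) :+ (i :+ i))) refl x i)
           (+-congˡ (-‿cong (sym (trans (int-+ (+ 4) (+ (k ℕ.+ k))) (+-congˡ (int-+ (+ k) (+ k))))))))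
      shift (rest _ _) = solve 1 (λ x → (x :+ con (+ 1) :+ con (+ 1)) := x :- con (ℤ.- + 2)) refl x

-- Summing the absolute eigenvalues over the edges, in ℕ

sum-filter : ∀ {A : Set} {P : Pred A 0ℓ} (P? : U.Decidable P) (f : A → ℕ) xs →
  sumℕ (map f (filter P? xs)) ≡ sumℕ (map (λ x → if does (P? x) then f x else 0) xs)
sum-filter P? f []       = ≡.refl
sum-filter P? f (x ∷ xs) with does (P? x)
... | true  = ≡.cong (f x ℕ.+_) (sum-filter P? f xs)
... | false = sum-filter P? f xs

sum-cartesianProduct : ∀ {A B : Set} (f : A × B → ℕ) xs ys →
  sumℕ (map f (cartesianProduct xs ys)) ≡ sumℕ (map (λ x → sumℕ (map (λ y → f (x , y)) ys)) xs)
sum-cartesianProduct f []       ys = ≡.refl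
sum-cartesianProduct f (x ∷ xs) ys = begin
  sumℕ (map f (map (x ,_) ys ++ cartesianProduct xs ys))
    ≡⟨ ≡.cong sumℕ (List.map-++ f (map (x ,_) ys) _) ⟩
  sumℕ (map f (map (x ,_) ys) ++ map f (cartesianProduct xs ys))
    ≡⟨ sum-++ (map f (map (x ,_) ys)) _ ⟩
  sumℕ (map f (map (x ,_) ys)) ℕ.+ sumℕ (map f (cartesianProduct xs ys))
    ≡⟨ ≡.cong₂ ℕ._+_ (≡.cong sumℕ (≡.sym (List.map-∘ ys))) (sum-cartesianProduct f xs ys) ⟩
  sumℕ (map (λ y → f (x , y)) ys) ℕ.+ sumℕ (map (λ x → sumℕ (map (λ y → f (x , y)) ys)) xs) ∎
  where
  open ≡-Reasoning

Σℕ : ∀ {n} → (Fin n → ℕ) → ℕ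
Σℕ f = sumℕ (tabulate f)

Σℕ-cong : ∀ {n} {f g : Fin n → ℕ} → (∀ i → f i ≡ g i) → Σℕ f ≡ Σℕ g
Σℕ-cong h = ≡.cong sumℕ (List.tabulate-cong h)

Σℕ-const : ∀ n c → Σℕ {n} (λ _ → c) ≡ n ℕ.* c
Σℕ-const zero    c = ≡.refl
Σℕ-const (suc n) c = ≡.cong (c ℕ.+_) (Σℕ-const n c)

sum-allFin : ∀ {n} (f : Fin n → ℕ) → sumℕ (map f (allFin n)) ≡ Σℕ f
sum-allFin f = ≡.cong sumℕ (List.map-tabulate id f)

-- The weight 2 is the absolute value of the eigenvalue -2; it also spares halving the number of
-- pairs.
Σℕ-pairs : ∀ n → Σℕ {suc n} (λ i → Σℕ {suc n} λ j → if toℕ i <ᵇ toℕ j then 2 else 0) ≡ n ℕ.* suc n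
Σℕ-pairs zero    = ≡.refl
Σℕ-pairs (suc n) = begin
  Σℕ {suc n} (λ _ → 2) ℕ.+ Σℕ {suc n} (λ i → Σℕ {suc n} λ j → if toℕ i <ᵇ toℕ j then 2 else 0)
    ≡⟨ ≡.cong₂ ℕ._+_ (Σℕ-const (suc n) 2) (Σℕ-pairs n) ⟩
  suc n ℕ.* 2 ℕ.+ n ℕ.* suc n
    ≡⟨ solve 1 (λ n → (con 1 :+ n) :* con 2 :+ n :* (con 1 :+ n) :=
                   (con 1 :+ n) :* (con 2 :+ n)) ≡.refl n ⟩
  suc n ℕ.* suc (suc n) ∎
  where
  open ≡-Reasoning
  open ℕSolver.+-*-Solver

-- Here p ≥ 5 enters: with m = p - 1 = 4 + k, the star eigenvalue m - 4 is the natural number `k`,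
-- its own absolute value.
∣eigenvalue∣ : ∀ k → Kind (3 ℕ.+ k) → ℕ
∣eigenvalue∣ k (star _)   = k
∣eigenvalue∣ k base       = 4 ℕ.+ (k ℕ.+ k)
∣eigenvalue∣ k (rest _ _) = 2

Σ-∣eigenvalue∣ : ∀ k → Σℕ {4 ℕ.+ k} (λ u → Σℕ {4 ℕ.+ k} λ v →
  if toℕ u <ᵇ toℕ v then ∣eigenvalue∣ k (kind u v) else 0) ≡ 2 ℕ.* ((1 ℕ.+ k) ℕ.* (4 ℕ.+ k))
Σ-∣eigenvalue∣ k = begin
  -- The clauses of `kind` let the double sum unfold to this by computation. Row 0 has the 3 + k
  -- star edges, row 1 the base edge and 1 + k rest edges, and the later rows hold the pairs among
  -- the last 2 + k vertices.
  Σℕ {3 ℕ.+ k} (λ _ → k) ℕ.+ ((4 ℕ.+ (k ℕ.+ k) ℕ.+ Σℕ {1 ℕ.+ k} (λ _ → 2)) ℕ.+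
    Σℕ {2 ℕ.+ k} (λ i → Σℕ {2 ℕ.+ k} λ j → if toℕ i <ᵇ toℕ j then 2 else 0))
    ≡⟨ ≡.cong₂ ℕ._+_ (Σℕ-const (3 ℕ.+ k) k)
         (≡.cong₂ ℕ._+_ (≡.cong (4 ℕ.+ (k ℕ.+ k) ℕ.+_) (Σℕ-const (1 ℕ.+ k) 2)) (Σℕ-pairs (1 ℕ.+ k))) ⟩
  (3 ℕ.+ k) ℕ.* k ℕ.+ ((4 ℕ.+ (k ℕ.+ k) ℕ.+ (1 ℕ.+ k) ℕ.* 2) ℕ.+ (1 ℕ.+ k) ℕ.* (2 ℕ.+ k))
    ≡⟨ solve 1 (λ k → (con 3 :+ k) :* k :+
           ((con 4 :+ (k :+ k) :+ (con 1 :+ k) :* con 2) :+ (con 1 :+ k) :* (con 2 :+ k))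
         := con 2 :* ((con 1 :+ k) :* (con 4 :+ k))) ≡.refl k ⟩
  2 ℕ.* ((1 ℕ.+ k) ℕ.* (4 ℕ.+ k)) ∎
  where
  open ≡-Reasoning
  open ℕSolver.+-*-Solver

lookup-injective : ∀ {A : Set} {xs : List A} → Unique xs →
                   ∀ {i j} → lookup xs i ≡ lookup xs j → i ≡ j
lookup-injective (_ ∷ _)  {zero}  {zero}  e = ≡.refl
lookup-injective {xs = _ ∷ xs} (x∉ ∷ _) {zero}  {suc j} e =
  ⊥-elim (All.lookup x∉ (∈-lookup {xs = xs} j) e)
lookup-injective {xs = _ ∷ xs} (x∉ ∷ _) {suc i} {zero}  e =
  ⊥-elim (All.lookup x∉ (∈-lookup {xs = xs} i) (≡.sym e))
lookup-injective (_ ∷ u)  {suc i} {suc j} e = ≡.cong suc (lookup-injective u e)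

-- The energy of the line graph over the reals

open CommutativeRing ℝ-commutativeRing using () renaming
  ( refl to ≈-refl; sym to ≈-sym; trans to ≈-trans
  ; +-cong to +ᴿ-cong; +-congˡ to +ᴿ-congˡ; semiring to ℝ-semiring)
open Matrices ℝ-commutativeRing using (sum)
open IntegerCoefficients ℝ-commutativeRing using (int)

-- `i ℚ./ 1` reduces to lowest terms by a gcd, which is stuck for a variable `i`; unnormalised
-- fractions with denominator 1 add by computation.
fromℤ-+ : ∀ i j → fromℤ (i ℤ.+ j) ≈ᴿ fromℤ i +ᴿ fromℤ j
fromℤ-+ i j = pointwise λ _ → ℚ.toℚᵘ-injective (begin
  ℚ.toℚᵘ ((i ℤ.+ j) ℚ./ 1)
    ≈⟨ ℚ.toℚᵘ-fromℚᵘ (ℚᵘ.mkℚᵘ (i ℤ.+ j) 0) ⟩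
  ℚᵘ.mkℚᵘ (i ℤ.+ j) 0
    ≡⟨ ≡.cong₂ (λ a b → ℚᵘ.mkℚᵘ (a ℤ.+ b) 0) (ℤ.*-identityʳ i) (ℤ.*-identityʳ j) ⟨
  ℚᵘ.mkℚᵘ i 0 ℚᵘ.+ ℚᵘ.mkℚᵘ j 0
    ≈⟨ ℚᵘ.+-cong (ℚ.toℚᵘ-fromℚᵘ (ℚᵘ.mkℚᵘ i 0)) (ℚ.toℚᵘ-fromℚᵘ (ℚᵘ.mkℚᵘ j 0)) ⟨
  ℚ.toℚᵘ (i ℚ./ 1) ℚᵘ.+ ℚ.toℚᵘ (j ℚ./ 1)
    ≈⟨ ℚ.toℚᵘ-homo-+ (i ℚ./ 1) (j ℚ./ 1) ⟨
  ℚ.toℚᵘ (i ℚ./ 1 ℚ.+ j ℚ./ 1) ∎)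
  where
  open SetoidReasoning ℚᵘ.≃-setoid

int≈fromℤ : ∀ n → int (+ n) ≈ᴿ fromℤ (+ n)
int≈fromℤ zero    = ≈-refl
int≈fromℤ (suc n) = ≈-trans (Mult.1+× ℝ-semiring n 1ᴿ)
  (≈-trans (+ᴿ-congˡ (int≈fromℤ n)) (≈-sym (fromℤ-+ (+ 1) (+ n))))

∣fromℤ∣ : ∀ n → ∣ fromℤ (+ n) ∣ᴿ ≈ᴿ fromℤ (+ n)
∣fromℤ∣ n = pointwise λ _ → ℚ.0≤p⇒∣p∣≡p (ℚ.nonNegative⁻¹ _ {{ℚ.normalize-nonNeg n 1}})

sum-lookup : ∀ {A : Set} (xs : List A) (f : A → ℝ) (w : A → ℕ) → (∀ x → f x ≈ᴿ fromℤ (+ w x)) →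
             sum (λ i → f (lookup xs i)) ≈ᴿ fromℤ (+ sumℕ (map w xs))
sum-lookup []       f w h = ≈-refl
sum-lookup (x ∷ xs) f w h = ≈-trans (+ᴿ-cong (h x) (sum-lookup xs f w h))
  (≈-sym (fromℤ-+ (+ w x) (+ sumℕ (map w xs))))

sum-edges : ∀ G (f : Fin (Graph.order G) × Fin (Graph.order G) → ℕ) →
  sumℕ (map f (edges G)) ≡ Σℕ λ u → Σℕ λ v → if does (isEdge? G (u , v)) then f (u , v) else 0
sum-edges G f = begin
  sumℕ (map f (edges G))
    ≡⟨ sum-filter (isEdge? G) f (cartesianProduct V V) ⟩
  sumℕ (map g (cartesianProduct V V))
    ≡⟨ sum-cartesianProduct g V V ⟩
  sumℕ (map (λ u → sumℕ (map (λ v → g (u , v)) V)) V)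
    ≡⟨ sum-allFin (λ u → sumℕ (map (λ v → g (u , v)) V)) ⟩
  Σℕ (λ u → sumℕ (map (λ v → g (u , v)) V))
    ≡⟨ Σℕ-cong (λ u → sum-allFin λ v → g (u , v)) ⟩
  Σℕ (λ u → Σℕ λ v → g (u , v)) ∎
  where
  open ≡-Reasoning
  V = allFin (Graph.order G)
  g : Fin (Graph.order G) × Fin (Graph.order G) → ℕ
  g e = if does (isEdge? G e) then f e else 0

lineGraph-energy : ∀ k (G : Graph) → Graph.order G ≡ 4 ℕ.+ k → (∀ {u v} → u ≢ v → Graph._~_ G u v) →
  Energy (lineGraph G) (fromℤ (+ (2 ℕ.* ((1 ℕ.+ k) ℕ.* (4 ℕ.+ k)))))
-- Fixing the order as `4 ℕ.+ k` makes the vertices elements of `Fin (4 ℕ.+ k)`, as `kind` requires.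
lineGraph-energy k G@record { order = .(4 ℕ.+ k) ; _~_ = _~_ ; _~?_ = _~?_ } ≡.refl complete =
  eigenvalue adjacent? to from ∘ kindOf , eigenvalues adjacent? to from , ≈-sym energy
  where
  ordered : ∀ e → proj₁ (lookup (edges G) e) Fin.< proj₂ (lookup (edges G) e)
  ordered e = proj₁ (proj₂ (∈-filter⁻ (isEdge? G) {xs = cartesianProduct (allFin _) (allFin _)}
    (∈-lookup {xs = edges G} e)))

  index : ∀ {u v} → u Fin.< v → ∃[ e ] lookup (edges G) e ≡ (u , v)
  index {u} {v} u<v = Any.index uv∈ , ≡.sym (lookup-index uv∈)
    where
    uv∈ : (u , v) ∈ edges G
    uv∈ = ∈-filter⁺ (isEdge? G) (∈-cartesianProduct⁺ (∈-allFin u) (∈-allFin v))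
            (u<v , complete (Fin.<⇒≢ u<v))

  open CompleteLineGraph ℝ-commutativeRing k (lookup (edges G)) ordered
    (lookup-injective (edges-unique G)) index

  adjacent? = Graph._~?_ (lineGraph G)

  to : ∀ {e f} → Graph._~_ (lineGraph G) e f → lookup (edges G) e ≢ lookup (edges G) f ×
       Share (proj₁ (lookup (edges G) e)) (proj₂ (lookup (edges G) e))
             (proj₁ (lookup (edges G) f)) (proj₂ (lookup (edges G) f))
  to adj = adj

  from : ∀ {e f} → lookup (edges G) e ≢ lookup (edges G) f →
         Share (proj₁ (lookup (edges G) e)) (proj₂ (lookup (edges G) e))
               (proj₁ (lookup (edges G) f)) (proj₂ (lookup (edges G) f)) →
         Graph._~_ (lineGraph G) e f
  from e≢f share = e≢f , share

  abs : ∀ t → ∣ eigenvalue adjacent? to from t ∣ᴿ ≈ᴿ fromℤ (+ ∣eigenvalue∣ k t)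
  abs (star _)   = ≈-trans (∣∣ᴿ-cong (int≈fromℤ k)) (∣fromℤ∣ k)
  abs base       = ≈-trans (∣∣ᴿ-cong (int≈fromℤ (4 ℕ.+ (k ℕ.+ k)))) (∣fromℤ∣ (4 ℕ.+ (k ℕ.+ k)))
  abs (rest _ _) = pointwise λ _ → ≡.refl

  w : Fin (4 ℕ.+ k) × Fin (4 ℕ.+ k) → ℕ
  w (u , v) = ∣eigenvalue∣ k (kind u v)

  -- Completeness makes the adjacency test succeed whenever u < v. What stays is the order test,
  -- which computes to `_<ᵇ_`, the form summed in `Σ-∣eigenvalue∣`.
  restrict : ∀ {u v} x (a : Dec (u Fin.< v)) (b : Dec (u ~ v)) →
    (if does (a ×-dec b) then x else 0) ≡ (if does a then x else 0)
  restrict x (yes _)   (yes _)  = ≡.refl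
  restrict x (yes u<v) (no ¬uv) = ⊥-elim (¬uv (complete (Fin.<⇒≢ u<v)))
  restrict x (no _)    _        = ≡.refl

  total : sumℕ (map w (edges G)) ≡ 2 ℕ.* ((1 ℕ.+ k) ℕ.* (4 ℕ.+ k))
  total = begin
    sumℕ (map w (edges G))
      ≡⟨ sum-edges G w ⟩
    Σℕ (λ u → Σℕ λ v → if does (isEdge? G (u , v)) then w (u , v) else 0)
      ≡⟨ Σℕ-cong (λ u → Σℕ-cong λ v → restrict (w (u , v)) (u Fin.<? v) (u ~? v)) ⟩
    Σℕ (λ u → Σℕ λ v → if toℕ u <ᵇ toℕ v then w (u , v) else 0)
      ≡⟨ Σ-∣eigenvalue∣ k ⟩
    2 ℕ.* ((1 ℕ.+ k) ℕ.* (4 ℕ.+ k)) ∎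
    where
    open ≡-Reasoning

  energy : sum (λ e → ∣ eigenvalue adjacent? to from (kindOf e) ∣ᴿ) ≈ᴿ
           fromℤ (+ (2 ℕ.* ((1 ℕ.+ k) ℕ.* (4 ℕ.+ k))))
  energy = ≡.subst
    (λ t → sum (λ e → ∣ eigenvalue adjacent? to from (kindOf e) ∣ᴿ) ≈ᴿ fromℤ (+ t)) total
    (sum-lookup (edges G) (λ (u , v) → ∣ eigenvalue adjacent? to from (kind u v) ∣ᴿ) w
      λ (u , v) → abs (kind u v))

-- The zero-divisor graph of ℤ_{p²} is complete on p - 1 vertices

*ₙ-zero⇒∣ : ∀ {n} (x y : Fin n) → IsZero (x *ₙ y) → n ∣ toℕ x ℕ.* toℕ y
*ₙ-zero⇒∣ {n} x y z = m%n≡0⇒n∣m _ n {{Fin.nonZeroIndex x}}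
  (≡.trans (≡.sym (Fin.toℕ-fromℕ< (m%n<n _ n {{Fin.nonZeroIndex x}}))) z)

∣⇒*ₙ-zero : ∀ {n} (x y : Fin n) → n ∣ toℕ x ℕ.* toℕ y → IsZero (x *ₙ y)
∣⇒*ₙ-zero {n} x y d = ≡.trans (Fin.toℕ-fromℕ< (m%n<n _ n {{Fin.nonZeroIndex x}}))
  (n∣m⇒m%n≡0 _ n {{Fin.nonZeroIndex x}} d)

square : ∀ p → p ^ 2 ≡ p ℕ.* p
square p = ≡.cong (p ℕ.*_) (ℕ.*-identityʳ p)

module _ (q : ℕ) where

  private
    p : ℕ
    p = suc q

  -- From p² ∣ x y, Euclid's lemma gives p ∣ x or y = y′ p. In the second case cancelling p leaves p
  -- ∣ x y′, and p ∣ y′ is impossible: then p² would divide `y`, which is nonzero and below p².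
  zero-divisor⇒∣ : Prime p → ∀ {x : Fin (p ^ 2)} → IsNonzeroZeroDivisor x → p ∣ toℕ x
  zero-divisor⇒∣ p-prime {x} (_ , y , y≢0 , xy≡0) with *ₙ-zero⇒∣ x y xy≡0
  ... | p²∣xy with euclidsLemma (toℕ x) (toℕ y) p-prime (∣-trans (m∣m*n (p ^ 1)) p²∣xy)
  ...   | inj₁ p∣x             = p∣x
  ...   | inj₂ (divides y′ y≡) with euclidsLemma (toℕ x) y′ p-prime (*-cancelˡ-∣ p p*p∣p*xy′)
    where
    open ≡.≡-Reasoning
    p*p∣p*xy′ : p ℕ.* p ∣ p ℕ.* (toℕ x ℕ.* y′)
    p*p∣p*xy′ = ≡.subst₂ _∣_ (square p) (begin
      toℕ x ℕ.* toℕ y       ≡⟨ ≡.cong (toℕ x ℕ.*_) y≡ ⟩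
      toℕ x ℕ.* (y′ ℕ.* p)    ≡⟨ ℕ.*-assoc (toℕ x) y′ p ⟨
      toℕ x ℕ.* y′ ℕ.* p      ≡⟨ ℕ.*-comm _ p ⟩
      p ℕ.* (toℕ x ℕ.* y′)    ∎) p²∣xy
  ...     | inj₁ p∣x  = p∣x
  ...     | inj₂ p∣y′ = ⊥-elim (ℕ.<⇒≱ (Fin.toℕ<n y) (∣⇒≤ {{ℕ.≢-nonZero y≢0}}
    (≡.subst₂ _∣_ (≡.sym (square p)) (≡.sym y≡) (*-monoˡ-∣ p p∣y′))))

  multiple-< : (i : Fin q) → suc (toℕ i) ℕ.* p ℕ.< p ^ 2
  multiple-< i = ≡.subst (suc (toℕ i) ℕ.* p ℕ.<_) (≡.sym (square p))
    (ℕ.*-monoˡ-< p (s≤s (Fin.toℕ<n i)))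

  -- Index `i` stands for (i + 1) p; the shift leaves out 0, so exactly q = p - 1 multiples are
  -- listed.
  multiple : Fin q → Fin (p ^ 2)
  multiple i = fromℕ< (multiple-< i)

  toℕ-multiple : ∀ i → toℕ (multiple i) ≡ suc (toℕ i) ℕ.* p
  toℕ-multiple i = Fin.toℕ-fromℕ< (multiple-< i)

  multiple-injective : ∀ {i j} → multiple i ≡ multiple j → i ≡ j
  multiple-injective {i} {j} e = Fin.toℕ-injective (ℕ.suc-injective (ℕ.*-cancelʳ-≡ _ _ p
    (≡.trans (≡.sym (toℕ-multiple i)) (≡.trans (≡.cong toℕ e) (toℕ-multiple j)))))

  ∣⇒multiple : ∀ {x : Fin (p ^ 2)} → ¬ IsZero x → p ∣ toℕ x → ∃[ i ] x ≡ multiple i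
  ∣⇒multiple x≢0 (divides zero    x≡) = ⊥-elim (x≢0 x≡)
  ∣⇒multiple {x} x≢0 (divides (suc d) x≡) = fromℕ< d<q ,
    Fin.toℕ-injective (≡.trans x≡ (≡.sym (≡.trans (toℕ-multiple (fromℕ< d<q))
      (≡.cong (λ d → suc d ℕ.* p) (Fin.toℕ-fromℕ< d<q)))))
    where
    d<q : d ℕ.< q
    d<q = ℕ.s≤s⁻¹ (ℕ.*-cancelʳ-< p (suc d) p
      (≡.subst₂ ℕ._<_ x≡ (square p) (Fin.toℕ<n x)))

  multiples-annihilate : ∀ {x y : Fin (p ^ 2)} → p ∣ toℕ x → p ∣ toℕ y → IsZero (x *ₙ y)
  multiples-annihilate {x} {y} p∣x p∣y = ∣⇒*ₙ-zero x y
    (≡.subst (_∣ toℕ x ℕ.* toℕ y) (≡.sym (square p)) (*-pres-∣ p∣x p∣y))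

  ∣multiple : ∀ i → p ∣ toℕ (multiple i)
  ∣multiple i = divides (suc (toℕ i)) (toℕ-multiple i)

  multiple≢0 : ∀ i → ¬ IsZero (multiple i)
  multiple≢0 i e with () ← ≡.trans (≡.sym (toℕ-multiple i)) e

  ∈-zeroDivisors⇒ : Prime p → ∀ {x} → x ∈ zeroDivisors (p ^ 2) → ¬ IsZero x × p ∣ toℕ x
  ∈-zeroDivisors⇒ p-prime x∈ with ∈-filter⁻ isNonzeroZeroDivisor? {xs = allFin _} x∈
  ... | _ , zd = proj₁ zd , zero-divisor⇒∣ p-prime zd

  multiple∈zeroDivisors : ∀ i → multiple i ∈ zeroDivisors (p ^ 2)
  multiple∈zeroDivisors i = ∈-filter⁺ isNonzeroZeroDivisor? (∈-allFin (multiple i))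
    -- Each multiple of p serves as its own annihilator, as p² divides its square.
    (multiple≢0 i , multiple i , multiple≢0 i , 
     multiples-annihilate {multiple i} {multiple i} (∣multiple i) (∣multiple i))

  -- The filtered list of zero-divisors does not compute for a variable p, so it is compared with
  -- the explicit `tabulate multiple`: duplicate-free lists with the same members are permutations
  -- of each other.
  zeroDivisorGraph-order : Prime p → Graph.order (zeroDivisorGraph (p ^ 2)) ≡ q
  zeroDivisorGraph-order p-prime = ≡.trans
    (↭-length (∼bag⇒↭ (unique∧set⇒bag
      (Unique.filter⁺ isNonzeroZeroDivisor? (Unique.allFin⁺ _)) (Unique.tabulate⁺ multiple-injective)
      (mk⇔ to from))))
    (List.length-tabulate multiple)
    where
    to : ∀ {x} → x ∈ zeroDivisors (p ^ 2) → x ∈ tabulate multiple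
    to x∈ with ∈-zeroDivisors⇒ p-prime x∈
    ... | x≢0 , p∣x with ∣⇒multiple x≢0 p∣x
    ...   | i , ≡.refl = ∈-tabulate⁺ i
    from : ∀ {x} → x ∈ tabulate multiple → x ∈ zeroDivisors (p ^ 2)
    from x∈ with ∈-tabulate⁻ x∈
    ... | i , ≡.refl = multiple∈zeroDivisors i

  zeroDivisorGraph-complete : Prime p → ∀ {u v} → u ≢ v → Graph._~_ (zeroDivisorGraph (p ^ 2)) u v
  zeroDivisorGraph-complete p-prime {u} {v} u≢v =
    u≢v ∘ lookup-injective (Unique.filter⁺ isNonzeroZeroDivisor? (Unique.allFin⁺ _)) ,
    multiples-annihilate {lookup zds u} {lookup zds v}
      (proj₂ (∈-zeroDivisors⇒ p-prime (∈-lookup {xs = zds} u)))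
      (proj₂ (∈-zeroDivisors⇒ p-prime (∈-lookup {xs = zds} v)))
    where
    zds = zeroDivisors (p ^ 2)

-- With p = 5 + k the left side is 2 (p - 4) (p - 1), that is 2 m (m - 3). The equation is solved in
-- ℤ, where the subtraction of 10 p is not truncated.
energy≡ : ∀ k → + (2 ℕ.* ((1 ℕ.+ k) ℕ.* (4 ℕ.+ k))) ≡
          + 2 ℤ.* + ((5 ℕ.+ k) ^ 2) ℤ.- + 10 ℤ.* + (5 ℕ.+ k) ℤ.+ + 8
energy≡ k = begin
  + (2 ℕ.* ((1 ℕ.+ k) ℕ.* (4 ℕ.+ k)))
    ≡⟨ ≡.trans (ℤ.pos-* 2 ((1 ℕ.+ k) ℕ.* (4 ℕ.+ k))) (≡.cong (+ 2 ℤ.*_) (ℤ.pos-* (1 ℕ.+ k) (4 ℕ.+ k))) ⟩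
  + 2 ℤ.* ((+ 1 ℤ.+ + k) ℤ.* (+ 4 ℤ.+ + k))
    ≡⟨ solve 1 (λ k → con (+ 2) :* ((con (+ 1) :+ k) :* (con (+ 4) :+ k)) :=
         con (+ 2) :* ((con (+ 5) :+ k) :* (con (+ 5) :+ k)) :- con (+ 10) :* (con (+ 5) :+ k) :+ con (+ 8))
         ≡.refl (+ k) ⟩
  + 2 ℤ.* (+ p ℤ.* + p) ℤ.- + 10 ℤ.* + p ℤ.+ + 8
    ≡⟨ ≡.cong (λ i → + 2 ℤ.* i ℤ.- + 10 ℤ.* + p ℤ.+ + 8)
         (≡.trans (≡.sym (ℤ.pos-* p p)) (≡.cong +_ (≡.sym (square p)))) ⟩
  + 2 ℤ.* + (p ^ 2) ℤ.- + 10 ℤ.* + p ℤ.+ + 8 ∎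
  where
  open ≡-Reasoning
  open ℤSolver.+-*-Solver
  p = 5 ℕ.+ k

zeroDivisorGraph-lineGraph-energy : ∀ k → Prime (5 ℕ.+ k) →
  Energy (lineGraph (zeroDivisorGraph ((5 ℕ.+ k) ^ 2)))
         (fromℤ (+ (2 ℕ.* ((1 ℕ.+ k) ℕ.* (4 ℕ.+ k)))))
zeroDivisorGraph-lineGraph-energy k p-prime =
  lineGraph-energy k (zeroDivisorGraph ((5 ℕ.+ k) ^ 2))
    (zeroDivisorGraph-order (4 ℕ.+ k) p-prime)
    (λ {u} {v} → zeroDivisorGraph-complete (4 ℕ.+ k) p-prime {u} {v})

open import Data.Integer.Base using (+_; _+_; _-_; _*_)

theorem3p4 : (p : ℕ) → Prime p → 5 ≤ p →
    Energy (lineGraph (zeroDivisorGraph (p ^ 2)))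
    (fromℤ (+ 2 * + (p ^ 2) - + 10 * + p + + 8))
theorem3p4 p p-prime 5≤p = from-excess (ℕ.m≤n⇒∃[o]m+o≡n 5≤p) p-prime
  where
  from-excess : ∀ {p} → ∃[ k ] 5 ℕ.+ k ≡ p → Prime p →
    Energy (lineGraph (zeroDivisorGraph (p ^ 2)))
      (fromℤ (+ 2 * + (p ^ 2) - + 10 * + p + + 8))
  from-excess (k , ≡.refl) p-prime = ≡.subst
    (λ i → Energy (lineGraph (zeroDivisorGraph ((5 ℕ.+ k) ^ 2))) (fromℤ i))
    (energy≡ k) (zeroDivisorGraph-lineGraph-energy k p-prime)
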